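{- Let $C_k$ be a cycle of even order $k$. Then for every integer $m \geq 2$, $$\frac{k+8}{4} \leq af(C_k^m) \leq \frac{k(k-2)}{4}.$$
   Context: All graphs are simple. A perfect matching of a graph $G$ is a set of pairwise disjoint edges covering all vertices of $G$. For $S \subseteq E(G)$, $S$ is an anti-forcing set if the graph $G - S$ obtained by deleting the edges of $S$ has a unique perfect matching. The anti-forcing number $af(G)$ is the minimum cardinality of an anti-forcing set of $G$. For $m \in \mathbb{N}$, the $m$-th power $G^m$ is the graph on $V(G)$ in which two distinct vertices are adjacent iff their distance in $G$ is at most $m$.
   Formalization: The formal theorem assumes k ≥ 6, excluding k = 4, where the claim is false: C_4^m is K_4 with anti-forcing number 2, while the stated lower bound would be 3. -}

module Defs where

open import Data.Nat using (ℕ; zero; suc; _≤_; _<_)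
open import Data.Fin using (Fin; toℕ)
open import Data.Product using (Σ; ∃; _×_; _,_; proj₁; proj₂)
open import Data.Sum using (_⊎_)
open import Data.List using (List; length)
open import Data.List.Membership.Propositional using (_∈_)
open import Data.List.Relation.Unary.All using (All)
open import Data.List.Relation.Unary.Unique.Propositional using (Unique)
open import Relation.Nullary using (¬_)
open import Relation.Binary.PropositionalEquality using (_≡_; _≢_)

-- A graph on the vertex set Fin n, given by its (symmetric, irreflexive)
-- adjacency relation.
Graph : ℕ → Set₁
Graph n = Fin n → Fin n → Set

CycleAdj : (k : ℕ) → Graph k
CycleAdj k i j =
  (toℕ j ≡ suc (toℕ i)) ⊎ (toℕ i ≡ suc (toℕ j))
  ⊎ ((suc (toℕ i) ≡ k × toℕ j ≡ 0) ⊎ (suc (toℕ j) ≡ k × toℕ i ≡ 0))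

Cycle : (k : ℕ) → Graph k
Cycle = CycleAdj

data Walk {n : ℕ} (G : Graph n) : Fin n → Fin n → ℕ → Set where
  here : ∀ {i} → Walk G i i 0
  step : ∀ {i j l ℓ} → G i j → Walk G j l ℓ → Walk G i l (suc ℓ)

DistAtMost : ∀ {n} → Graph n → ℕ → Fin n → Fin n → Set
DistAtMost G m i j = Σ ℕ λ ℓ → ℓ ≤ m × Walk G i j ℓ

Power : ∀ {n} → Graph n → ℕ → Graph n
Power G m i j = i ≢ j × DistAtMost G m i j

-- A perfect matching, represented as the partner function: a fixed-point-free
-- involution p with every pair {i, p i} an edge of G.  (The matching is the
-- edge set {{i, p i}}.)
record PerfectMatching {n : ℕ} (G : Graph n) : Set where
  field
    partner    : Fin n → Fin n
    involutive : ∀ i → partner (partner i) ≡ i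
    noFixed    : ∀ i → partner i ≢ i
    isEdge     : ∀ i → G i (partner i)
open PerfectMatching public

UniquePM : ∀ {n} → Graph n → Set
UniquePM G = Σ (PerfectMatching G) λ M →
  ∀ (M' : PerfectMatching G) → ∀ i → partner M' i ≡ partner M i

record EdgeSet {n : ℕ} (G : Graph n) : Set where
  field
    edges   : List (Fin n × Fin n)
    ordered : All (λ e → toℕ (proj₁ e) < toℕ (proj₂ e)) edges
    inG     : All (λ e → G (proj₁ e) (proj₂ e)) edges
    unique  : Unique edges
open EdgeSet public

card : ∀ {n} {G : Graph n} → EdgeSet G → ℕ
card S = length (edges S)

_∈E_ : ∀ {n} {G : Graph n} → Fin n × Fin n → EdgeSet G → Set
(i , j) ∈E S = ((i , j) ∈ edges S) ⊎ ((j , i) ∈ edges S)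

deleteEdges : ∀ {n} (G : Graph n) → EdgeSet G → Graph n
deleteEdges G S i j = G i j × ¬ ((i , j) ∈E S)

IsAntiForcingSet : ∀ {n} (G : Graph n) → EdgeSet G → Set
IsAntiForcingSet G S = UniquePM (deleteEdges G S)

IsAntiForcingNumber : ∀ {n} → Graph n → ℕ → Set
IsAntiForcingNumber G a =
  (Σ (EdgeSet G) λ S → IsAntiForcingSet G S × card S ≡ a)
  × (∀ (S : EdgeSet G) → IsAntiForcingSet G S → a ≤ card S)

{-# OPTIONS --safe #-}
-- Write G for the m-th power of the cycle, k = 2n, and M for the unique perfect
-- matching of R = G − S.
--
-- Upper bound: delete all edges from an odd vertex to a larger one; then
-- {0,1}, {2,3}, … is forced from left to right, and at most n(n − 1) edges are deleted.
--
-- Lower bound, m ≥ 3.  A graph with a unique perfect matching M has a bridge in M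
-- (Kotzig).  Cutting at bridges recursively yields a set X of at least n + 1 vertices
-- such that every edge of R inside X belongs to M.  The triangles {i, i+1, i+3}
-- partition the edges of the cube of the cycle, and each of them has at least
-- |X ∩ triangle| − 1 edges inside X; at most |X|/2 of these edges survive in R.
--
-- Lower bound, m = 2.  M consists of edges {i, i+1} and of crossing pairs {i, i+2},
-- {i+1, i+3}, and all these blocks start at the same parity.  View the square of the
-- cycle as a circular ladder with rungs {2j, 2j+1}, rails {i, i+2} and diagonals
-- {2j+1, 2j+2}, where M uses only rungs and pairs of parallel rails ("links").  With q
-- links there are n − q edge-disjoint alternating cycles in the ladder, one around each
-- gap that is not a link, and one more through all diagonals, which suffices when
-- n − 2q ≥ 2.  If n − 2q ≤ 1 the matching is determined up to rotation, and one uses the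
-- q short cycles inside the links together with two or three cycles around the ladder.
module Submission where

open import Defs
open import Data.Bool using (Bool; true; false; not)
import Data.Bool.Properties as Bool
open import Data.Empty using (⊥)
open import Data.Fin using (Fin; toℕ) renaming (zero to fzero; suc to fsuc)
open import Data.Fin.Permutation.Components using (transpose)
open import Data.Fin.Properties using (any?; all?; toℕ<n; toℕ-injective; toℕ-fromℕ<) renaming (_≟_ to _≟ᶠ_)
open import Data.List using (List; []; _∷_; length; filter; allFin; cartesianProduct)
import Data.List.Membership.DecPropositional as DecMembership
open import Data.List.Membership.Propositional using (_∈_)
open import Data.List.Membership.Propositional.Properties using (∈-filter⁺; ∈-filter⁻; ∈-cartesianProduct⁺; ∈-allFin)
import Data.List.Relation.Unary.All as All
import Data.List.Relation.Unary.All.Properties as All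
open import Data.List.Relation.Unary.AllPairs using ([]; _∷_)
open import Data.List.Relation.Unary.Any using (here; there)
import Data.List.Relation.Unary.Unique.Propositional as U
open import Data.List.Relation.Unary.Unique.Propositional.Properties using (filter⁺; cartesianProduct⁺; allFin⁺)
open import Data.Nat using (ℕ; zero; suc; _+_; _*_; _∸_; _≤_; _<_; z≤n; s≤s; NonZero; >-nonZero; _%_; _<?_)
open import Data.Nat.DivMod using (_mod_; _/_; m%n<n; m<n⇒m%n≡m; [m+n]%n≡m%n; [m+kn]%n≡m%n; %-distribˡ-+; m%n%n≡m%n; n%n≡0; m≡m%n+[m/n]*n)
open import Data.Nat.Divisibility using (_∣_; divides)
open import Data.Nat.Properties
open import Data.Nat.Tactic.RingSolver using (solve-∀)
open import Data.Product using (Σ; ∃; _×_; _,_; proj₁; proj₂)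
open import Data.Product.Properties using (≡-dec)
open import Data.Sum using (_⊎_; inj₁; inj₂)
import Data.Sum as Sum
open import Data.Unit using (⊤; tt)
open import Function using (_∘_)
open import Relation.Binary.Definitions using (tri<; tri≈; tri>)
open import Relation.Binary.PropositionalEquality
open import Relation.Nullary using (¬_; Dec; yes; no; contradiction)
open import Relation.Nullary.Decidable using (True; toWitness; map′; _×-dec_; _→-dec_; _⊎-dec_; ¬?)


-- Indicators of decidable statements and finite sums.

ind : ∀ {ℓ} {P : Set ℓ} → Dec P → ℕ
ind (yes _) = 1
ind (no _)  = 0

ind-yes : ∀ {ℓ} {P : Set ℓ} (d : Dec P) → P → ind d ≡ 1
ind-yes (yes _) _ = refl
ind-yes (no ¬p) p = contradiction p ¬p

ind-no : ∀ {ℓ} {P : Set ℓ} (d : Dec P) → ¬ P → ind d ≡ 0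
ind-no (yes p) ¬p = contradiction p ¬p
ind-no (no _)  _  = refl

ind-≤1 : ∀ {ℓ} {P : Set ℓ} (d : Dec P) → ind d ≤ 1
ind-≤1 (yes _) = s≤s z≤n
ind-≤1 (no _)  = z≤n

ind≡0⇒¬ : ∀ {ℓ} {P : Set ℓ} (d : Dec P) → ind d ≡ 0 → ¬ P
ind≡0⇒¬ (no ¬p) _ = ¬p

ind-mono : ∀ {ℓ ℓ′} {P : Set ℓ} {Q : Set ℓ′} (d : Dec P) (e : Dec Q) →
           (P → Q) → ind d ≤ ind e
ind-mono (yes p) e f = ≤-reflexive (sym (ind-yes e (f p)))
ind-mono (no _)  e f = z≤n

ind-cong : ∀ {ℓ ℓ′} {P : Set ℓ} {Q : Set ℓ′} (d : Dec P) (e : Dec Q) →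
           (P → Q) → (Q → P) → ind d ≡ ind e
ind-cong d e f g = ≤-antisym (ind-mono d e f) (ind-mono e d g)

∑ : ℕ → (ℕ → ℕ) → ℕ
∑ zero    f = 0
∑ (suc n) f = ∑ n f + f n

∑-mono-< : ∀ n {f g} → (∀ i → i < n → f i ≤ g i) → ∑ n f ≤ ∑ n g
∑-mono-< zero    h = z≤n
∑-mono-< (suc n) h =
  +-mono-≤ (∑-mono-< n (λ i i<n → h i (m<n⇒m<1+n i<n))) (h n (n<1+n n))

∑-mono : ∀ n {f g} → (∀ i → f i ≤ g i) → ∑ n f ≤ ∑ n g
∑-mono n h = ∑-mono-< n (λ i _ → h i)

∑-cong-< : ∀ n {f g} → (∀ i → i < n → f i ≡ g i) → ∑ n f ≡ ∑ n g
∑-cong-< n h = ≤-antisym (∑-mono-< n (λ i p → ≤-reflexive (h i p)))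
                         (∑-mono-< n (λ i p → ≤-reflexive (sym (h i p))))

∑-cong : ∀ n {f g} → (∀ i → f i ≡ g i) → ∑ n f ≡ ∑ n g
∑-cong n h = ∑-cong-< n (λ i _ → h i)

private
  interchange : ∀ a b c d → (a + b) + (c + d) ≡ (a + c) + (b + d)
  interchange = solve-∀

∑-+ : ∀ n f g → ∑ n (λ i → f i + g i) ≡ ∑ n f + ∑ n g
∑-+ zero    f g = refl
∑-+ (suc n) f g = trans (cong (_+ (f n + g n)) (∑-+ n f g))
                        (interchange (∑ n f) (∑ n g) (f n) (g n))

∑-*ˡ : ∀ n c f → ∑ n (λ i → c * f i) ≡ c * ∑ n f
∑-*ˡ zero    c f = sym (*-zeroʳ c)
∑-*ˡ (suc n) c f = trans (cong (_+ c * f n) (∑-*ˡ n c f))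
                         (sym (*-distribˡ-+ c (∑ n f) (f n)))

∑-const : ∀ n c → ∑ n (λ _ → c) ≡ n * c
∑-const zero    c = refl
∑-const (suc n) c = trans (cong (_+ c) (∑-const n c)) (+-comm (n * c) c)

∑-zero : ∀ n {f} → (∀ i → i < n → f i ≡ 0) → ∑ n f ≡ 0
∑-zero n h = trans (∑-cong-< n h) (trans (∑-const n 0) (*-zeroʳ n))

∑-swap : ∀ n m (f : ℕ → ℕ → ℕ) →
         ∑ n (λ i → ∑ m (f i)) ≡ ∑ m (λ j → ∑ n (λ i → f i j))
∑-swap zero    m f = sym (∑-zero m (λ _ _ → refl))
∑-swap (suc n) m f = trans (cong (_+ ∑ m (f n)) (∑-swap n m f))
                           (sym (∑-+ m (λ j → ∑ n (λ i → f i j)) (f n)))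

∑-suc : ∀ n f → ∑ (suc n) f ≡ f 0 + ∑ n (f ∘ suc)
∑-suc zero    f = +-comm 0 (f 0)
∑-suc (suc n) f = trans (cong (_+ f (suc n)) (∑-suc n f))
                        (+-assoc (f 0) (∑ n (f ∘ suc)) (f (suc n)))

∑-term : ∀ n f {i} → i < n → f i ≤ ∑ n f
∑-term (suc n) f {i} i<1+n with m≤n⇒m<n∨m≡n (≤-pred i<1+n)
... | inj₁ i<n  = ≤-trans (∑-term n f i<n) (m≤m+n (∑ n f) (f n))
... | inj₂ refl = m≤n+m (f n) (∑ n f)

∑≡0⇒ : ∀ n f → ∑ n f ≡ 0 → ∀ {i} → i < n → f i ≡ 0
∑≡0⇒ n f eq i<n = n≤0⇒n≡0 (≤-trans (∑-term n f i<n) (≤-reflexive eq))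

∑-strict : ∀ n {f g} → (∀ i → i < n → f i ≤ g i) → ∀ {i} → i < n → f i < g i →
           ∑ n f < ∑ n g
∑-strict (suc n) {f} {g} h {i} i<1+n fi<gi with m≤n⇒m<n∨m≡n (≤-pred i<1+n)
... | inj₁ i<n  = +-mono-<-≤ (∑-strict n (λ j p → h j (m<n⇒m<1+n p)) i<n fi<gi)
                             (h n (n<1+n n))
... | inj₂ refl = +-mono-≤-< (∑-mono-< n (λ j p → h j (m<n⇒m<1+n p))) fi<gi

∑-find : ∀ n f → 0 < ∑ n f → ∃ λ i → i < n × 0 < f i
∑-find (suc n) f pos with f n in eq
... | suc _ = n , n<1+n n , subst (0 <_) (sym eq) (s≤s z≤n)
... | zero  with ∑-find n f (subst (0 <_) (+-identityʳ (∑ n f)) pos)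
...   | i , i<n , fi = i , m<n⇒m<1+n i<n , fi

-- Doubling by recursion: dbl (suc j) + z then reduces to suc (suc (dbl j + z)).
dbl : ℕ → ℕ
dbl zero    = 0
dbl (suc j) = suc (suc (dbl j))

∑-even-odd : ∀ n f → ∑ (dbl n) f ≡ ∑ n (λ j → f (dbl j) + f (suc (dbl j)))
∑-even-odd zero    f = refl
∑-even-odd (suc n) f =
  trans (+-assoc (∑ (dbl n) f) (f (dbl n)) (f (suc (dbl n))))
        (cong (_+ (f (dbl n) + f (suc (dbl n)))) (∑-even-odd n f))

∑-shift : ∀ n f → f n ≡ f 0 → ∑ n (f ∘ suc) ≡ ∑ n f
∑-shift n f eq = +-cancelˡ-≡ (f 0) _ _ (begin
  f 0 + ∑ n (f ∘ suc)  ≡⟨ sym (∑-suc n f) ⟩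
  ∑ n f + f n          ≡⟨ +-comm (∑ n f) (f n) ⟩
  f n + ∑ n f          ≡⟨ cong (_+ ∑ n f) eq ⟩
  f 0 + ∑ n f          ∎)
  where open ≡-Reasoning

∑-rotate : ∀ n f → (∀ i → f (i + n) ≡ f i) → ∀ c → ∑ n (λ i → f (i + c)) ≡ ∑ n f
∑-rotate n f per zero    = ∑-cong n (λ i → cong f (+-identityʳ i))
∑-rotate n f per (suc c) =
  trans (∑-cong n (λ i → cong f (+-suc i c)))
  (trans (∑-shift n (λ i → f (i + c))
            (trans (cong f (+-comm n c)) (per c)))
         (∑-rotate n f per c))

-- Vertices numbered modulo `k`.

module CyclicOrder (k : ℕ) ⦃ k≢0 : NonZero k ⦄ where

  -- Every natural number names a vertex, as on an unrolled cycle: `v (d + i)` lies d steps after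
  -- `v i`, with no case distinction where the numbering wraps around.
  v : ℕ → Fin k
  v i = i mod k

  toℕ-v : ∀ i → toℕ (v i) ≡ i % k
  toℕ-v i = toℕ-fromℕ< (m%n<n i k)

  toℕ-v-< : ∀ {i} → i < k → toℕ (v i) ≡ i
  toℕ-v-< {i} i<k = trans (toℕ-v i) (m<n⇒m%n≡m i<k)

  v-cong : ∀ {i j} → i % k ≡ j % k → v i ≡ v j
  v-cong {i} {j} eq = toℕ-injective (trans (toℕ-v i) (trans eq (sym (toℕ-v j))))

  v-injective : ∀ {i j} → v i ≡ v j → i % k ≡ j % k
  v-injective {i} {j} eq = trans (sym (toℕ-v i)) (trans (cong toℕ eq) (toℕ-v j))

  v-toℕ : ∀ x → v (toℕ x) ≡ x
  v-toℕ x = toℕ-injective (toℕ-v-< (toℕ<n x))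

  v-+k : ∀ i → v (i + k) ≡ v i
  v-+k i = v-cong ([m+n]%n≡m%n i k)

  v-k+ : ∀ i → v (k + i) ≡ v i
  v-k+ i = trans (cong v (+-comm k i)) (v-+k i)

  v-+-cong : ∀ c {i j} → v i ≡ v j → v (c + i) ≡ v (c + j)
  v-+-cong c {i} {j} eq = v-cong (begin
    (c + i) % k            ≡⟨ %-distribˡ-+ c i k ⟩
    (c % k + i % k) % k    ≡⟨ cong (λ r → (c % k + r) % k) (v-injective eq) ⟩
    (c % k + j % k) % k    ≡⟨ %-distribˡ-+ c j k ⟨
    (c + j) % k            ∎)
    where open ≡-Reasoning

  -- Adding `c * k ∸ c` completes the shift by `c` to `c` full turns and thereby undoes it.
  v-+-cancel : ∀ c {i j} → v (c + i) ≡ v (c + j) → v i ≡ v j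
  v-+-cancel c {i} {j} eq = trans (shrink i) (trans (v-+-cong (c * k ∸ c) eq) (sym (shrink j)))
    where
    c≤c*k : c ≤ c * k
    c≤c*k = m≤m*n c k
    shrink : ∀ t → v t ≡ v (c * k ∸ c + (c + t))
    shrink t = begin
      v t                         ≡⟨ v-cong (sym ([m+kn]%n≡m%n t c k)) ⟩
      v (t + c * k)               ≡⟨ cong v (+-comm t (c * k)) ⟩
      v (c * k + t)               ≡⟨ cong (λ s → v (s + t)) (m∸n+n≡m c≤c*k) ⟨
      v (c * k ∸ c + c + t)       ≡⟨ cong v (+-assoc (c * k ∸ c) c t) ⟩
      v (c * k ∸ c + (c + t))     ∎
      where open ≡-Reasoning

  v-≢ : ∀ i a b → a < b → b < a + k → v (a + i) ≢ v (b + i)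
  v-≢ i a b a<b b<a+k eq = <⇒≢ 0<d (trans (sym (m<n⇒m%n≡m 0<k)) (trans (v-injective v0≡vd) (m<n⇒m%n≡m d<k)))
    where
    d = b ∸ a
    0<d : 0 < d
    0<d = m<n⇒0<n∸m a<b
    d<k : d < k
    d<k = +-cancelˡ-< a d k (subst (_< a + k) (sym (m+[n∸m]≡n (<⇒≤ a<b))) b<a+k)
    0<k : 0 < k
    0<k = <-trans 0<d d<k
    v0≡vd : v 0 ≡ v d
    v0≡vd = v-+-cancel i (v-+-cancel a (begin
      v (a + (i + 0))    ≡⟨ cong (λ t → v (a + t)) (+-identityʳ i) ⟩
      v (a + i)          ≡⟨ eq ⟩
      v (b + i)          ≡⟨ cong (λ t → v (t + i)) (m+[n∸m]≡n (<⇒≤ a<b)) ⟨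
      v (a + d + i)      ≡⟨ cong v (+-assoc a d i) ⟩
      v (a + (d + i))    ≡⟨ cong (λ t → v (a + t)) (+-comm d i) ⟩
      v (a + (i + d))    ∎))
      where open ≡-Reasoning

  cover : ∀ z x → ∃ λ t → t < k × x ≡ v (t + z)
  cover z x = t % k , m%n<n t k , (begin
      x                            ≡⟨ v-toℕ x ⟨
      v (toℕ x)                    ≡⟨ v-cong (sym ([m+kn]%n≡m%n (toℕ x) z k)) ⟩
      v (toℕ x + z * k)            ≡⟨ cong v (+-comm (toℕ x) (z * k)) ⟩
      v (z * k + toℕ x)            ≡⟨ cong (λ s → v (s + toℕ x)) (m+[n∸m]≡n (m≤m*n z k)) ⟨
      v (z + (z * k ∸ z) + toℕ x)  ≡⟨ cong v (+-assoc z _ (toℕ x)) ⟩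
      v (z + t)                    ≡⟨ v-+-cong z (v-cong (sym (m%n%n≡m%n t k))) ⟩
      v (z + t % k)                ≡⟨ cong v (+-comm z (t % k)) ⟩
      v (t % k + z)                ∎)
    where
    open ≡-Reasoning
    t = z * k ∸ z + toℕ x

  ∑-point : ∀ x → ∑ k (λ i → ind (v i ≟ᶠ x)) ≡ 1
  ∑-point x = ≤-antisym (upper k ≤-refl)
    (≤-trans (≤-reflexive (sym (ind-yes (v (toℕ x) ≟ᶠ x) (v-toℕ x))))
             (∑-term k (λ i → ind (v i ≟ᶠ x)) (toℕ<n x)))
    where
    upper : ∀ n → n ≤ k → ∑ n (λ i → ind (v i ≟ᶠ x)) ≤ 1
    upper zero    _ = z≤n
    upper (suc n) n<k with v n ≟ᶠ x
    ... | no _     = ≤-trans (≤-reflexive (+-identityʳ _)) (upper n (<⇒≤ n<k))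
    ... | yes vn≡x = ≤-reflexive (cong (_+ 1) (∑-zero n λ i i<n →
            ind-no (v i ≟ᶠ x) λ vi≡x → <⇒≢ i<n (begin
              i          ≡⟨ toℕ-v-< (<-trans i<n n<k) ⟨
              toℕ (v i)  ≡⟨ cong toℕ (trans vi≡x (sym vn≡x)) ⟩
              toℕ (v n)  ≡⟨ toℕ-v-< n<k ⟩
              n          ∎)))
      where open ≡-Reasoning

  ∑-cyclic : (F : Fin k → ℕ) → ∀ c → ∑ k (λ i → F (v (i + c))) ≡ ∑ k (λ i → F (v i))
  ∑-cyclic F c = ∑-rotate k (λ i → F (v i)) (λ i → cong F (v-+k i)) c

-- Fixed-point-free involutions and the exchange of partners.

module Pairings (k : ℕ) ⦃ k≢0 : NonZero k ⦄ where
  open CyclicOrder k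

  -- No graph is involved: whether the pairs are edges is tracked separately, so that intermediate
  -- pairings may contain a few pairs that are not edges.
  record Pairing : Set where
    constructor pairing
    field
      mate    : Fin k → Fin k
      mate²   : ∀ x → mate (mate x) ≡ x
      mate-≢  : ∀ x → mate x ≢ x
  open Pairing public

  mate-sym : ∀ f {x y} → mate f x ≡ y → mate f y ≡ x
  mate-sym f {x} eq = trans (cong (mate f) (sym eq)) (mate² f x)

  mate-injective : ∀ f {x y} → mate f x ≡ mate f y → x ≡ y
  mate-injective f {x} {y} eq = trans (sym (mate² f x)) (trans (cong (mate f) eq) (mate² f y))

  transpose-fst : ∀ (i j : Fin k) → transpose i j i ≡ j
  transpose-fst i j with i ≟ᶠ i
  ... | yes _  = refl
  ... | no i≢i = contradiction refl i≢i

  transpose-snd : ∀ (i j : Fin k) → transpose i j j ≡ i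
  transpose-snd i j with j ≟ᶠ i
  ... | yes j≡i = j≡i
  ... | no _ with j ≟ᶠ j
  ...   | yes _  = refl
  ...   | no j≢j = contradiction refl j≢j

  transpose-other : ∀ (i j : Fin k) {z} → z ≢ i → z ≢ j → transpose i j z ≡ z
  transpose-other i j {z} z≢i z≢j with z ≟ᶠ i
  ... | yes z≡i = contradiction z≡i z≢i
  ... | no _ with z ≟ᶠ j
  ...   | yes z≡j = contradiction z≡j z≢j
  ...   | no _    = refl

  transpose² : ∀ (i j z : Fin k) → transpose i j (transpose i j z) ≡ z
  transpose² i j z = go (z ≟ᶠ i) (z ≟ᶠ j)
    where
    go : Dec (z ≡ i) → Dec (z ≡ j) → transpose i j (transpose i j z) ≡ z
    go (yes refl) _ = trans (cong (transpose z j) (transpose-fst z j)) (transpose-snd z j)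
    go (no _) (yes refl) = trans (cong (transpose i z) (transpose-snd i z)) (transpose-fst i z)
    go (no z≢i) (no z≢j) =
      trans (cong (transpose i j) (transpose-other i j z≢i z≢j)) (transpose-other i j z≢i z≢j)

  -- Replaces the pairs {a, f a}, {x, f x} by {a, f x}, {f a, x}.
  exchange : Pairing → Fin k → Fin k → Pairing
  -- Conjugation by the transposition of `mate f a` and `mate f x` keeps an involution without fixed
  -- points, whatever `a` and `x` are.
  exchange f a x = pairing (τ ∘ mate f ∘ τ)
    (λ z → trans (cong (τ ∘ mate f) (transpose² _ _ _))
                 (trans (cong τ (mate² f (τ z))) (transpose² _ _ z)))
    (λ z eq → mate-≢ f (τ z) (trans (sym (transpose² _ _ _)) (cong τ eq)))
    where τ = transpose (mate f a) (mate f x)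

  data ExchangeView (f : Pairing) (a x z z′ : Fin k) : Set where
    at-a   : z ≡ a → z′ ≡ mate f x → ExchangeView f a x z z′
    at-fa  : z ≡ mate f a → z′ ≡ x → ExchangeView f a x z z′
    at-x   : z ≡ x → z′ ≡ mate f a → ExchangeView f a x z z′
    at-fx  : z ≡ mate f x → z′ ≡ a → ExchangeView f a x z z′
    off    : z ≢ a → z ≢ mate f a → z ≢ x → z ≢ mate f x → z′ ≡ mate f z →
             ExchangeView f a x z z′

  module _ (f : Pairing) {a x : Fin k} (x≢a : x ≢ a) (x≢fa : x ≢ mate f a) where
    private
      b = mate f a
      y = mate f x
      τ = transpose b y
      a≢y : a ≢ y
      a≢y a≡y = x≢fa (sym (mate-sym f (sym a≡y)))

    exchange-a : mate (exchange f a x) a ≡ y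
    exchange-a = trans (cong (τ ∘ mate f) (transpose-other b y (≢-sym (mate-≢ f a)) a≢y))
                       (transpose-fst b y)

    exchange-x : mate (exchange f a x) x ≡ b
    exchange-x = trans (cong (τ ∘ mate f) (transpose-other b y x≢fa (≢-sym (mate-≢ f x))))
                       (transpose-snd b y)

    exchange-off : ∀ {z} → z ≢ a → z ≢ b → z ≢ x → z ≢ y → mate (exchange f a x) z ≡ mate f z
    exchange-off z≢a z≢b z≢x z≢y =
      trans (cong (τ ∘ mate f) (transpose-other b y z≢b z≢y))
            (transpose-other b y (z≢a ∘ mate-injective f) (z≢x ∘ mate-injective f))

    exchange-view : ∀ z → ExchangeView f a x z (mate (exchange f a x) z)
    exchange-view z = go (z ≟ᶠ a) (z ≟ᶠ b) (z ≟ᶠ x) (z ≟ᶠ y)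
      where
      go : Dec (z ≡ a) → Dec (z ≡ b) → Dec (z ≡ x) → Dec (z ≡ y) →
           ExchangeView f a x z (mate (exchange f a x) z)
      go (yes refl) _ _ _ = at-a refl exchange-a
      go _ (yes refl) _ _ = at-fa refl (mate-sym (exchange f a x) exchange-x)
      go _ _ (yes refl) _ = at-x refl exchange-x
      go _ _ _ (yes refl) = at-fx refl (mate-sym (exchange f a x) exchange-a)
      go (no z≢a) (no z≢b) (no z≢x) (no z≢y) =
        off z≢a z≢b z≢x z≢y (exchange-off z≢a z≢b z≢x z≢y)

  -- Exhaustive search, one value at a time. A function and the one rebuilt from its values agree
  -- only pointwise, so `P` has to respect pointwise equality.
  anyFunction? : ∀ n (P : (Fin n → Fin k) → Set) → (∀ {f g} → (∀ i → f i ≡ g i) → P f → P g) →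
                 (∀ f → Dec (P f)) → Dec (∃ P)
  anyFunction? zero P ext P? = map′ (_ ,_) (λ (f , Pf) → ext (λ ()) Pf) (P? (λ ()))
  anyFunction? (suc n) P ext P? =
    map′ (λ (x , g , Pg) → cons x g , Pg)
         (λ (f , Pf) → f fzero , f ∘ fsuc , ext (λ { fzero → refl ; (fsuc i) → refl }) Pf)
         (any? λ x → anyFunction? n (P ∘ cons x)
                       (λ eq → ext λ { fzero → refl ; (fsuc i) → eq i }) (P? ∘ cons x))
    where
    cons : Fin k → (Fin n → Fin k) → Fin (suc n) → Fin k
    cons x g fzero    = x
    cons x g (fsuc i) = g i

  size : {P : Fin k → Set} → (∀ x → Dec (P x)) → ℕ
  size P? = ∑ k (λ i → ind (P? (v i)))

  size-⊂ : ∀ {P Q : Fin k → Set} (P? : ∀ x → Dec (P x)) (Q? : ∀ x → Dec (Q x)) → (∀ {x} → P x → Q x) →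
           ∀ {x} → Q x → ¬ P x → size P? < size Q?
  size-⊂ P? Q? P⊆Q {x} Qx ¬Px =
    ∑-strict k (λ i _ → ind-mono (P? (v i)) (Q? (v i)) P⊆Q) (toℕ<n x)
      (subst (λ y → ind (P? y) < ind (Q? y)) (sym (v-toℕ x))
        (subst₂ _<_ (sym (ind-no (P? x) ¬Px)) (sym (ind-yes (Q? x) Qx)) (s≤s z≤n)))

  -- Unique perfect matchings: alternating cycles and the existence of a bridge.

  module UniqueMatching
    (R : Fin k → Fin k → Set) (R? : ∀ x y → Dec (R x y))
    (R-sym : ∀ {x y} → R x y → R y x) (R-irrefl : ∀ {x y} → R x y → x ≢ y)
    (p : Pairing) (p-real : ∀ x → R x (mate p x))
    (p-unique : ∀ f → (∀ x → R x (mate f x)) → ∀ x → mate f x ≡ mate p x)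
    where

    -- All pairs of f are edges, except possibly {a, b}.
    Near : Fin k → Fin k → Pairing → Set
    Near a b f = mate f a ≡ b × (∀ x → x ≢ a → x ≢ b → R x (mate f x))

    -- If the exceptional pair is an edge after all, `f` is a perfect matching of `R` and therefore
    -- agrees with `p`.
    near-closed : ∀ {a b} f → Near a b f → R a b → mate p a ≡ b
    near-closed {a} {b} f (fa≡b , real) Rab = trans (sym (p-unique f all-real a)) fa≡b
      where
      all-real : ∀ x → R x (mate f x)
      all-real x with x ≟ᶠ a | x ≟ᶠ b
      ... | yes refl | _ = subst (R a) (sym fa≡b) Rab
      ... | no _ | yes refl = subst (R b) (sym (mate-sym f fa≡b)) (R-sym Rab)
      ... | no x≢a | no x≢b = real x x≢a x≢b

    -- Two further edges of an alternating path starting at `a`: the edge from `b` to `x` enters the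
    -- pairing, the pair of `x` is broken up, and its other vertex becomes the new end.
    near-step : ∀ {a b} f {x} → Near a b f → R b x → x ≢ a → Near a (mate f x) (exchange f a x)
    near-step {a} {b} f {x} (refl , real) Rbx x≢a = exchange-a f x≢a x≢b , real′
      where
      x≢b = ≢-sym (R-irrefl Rbx)
      real′ : ∀ z → z ≢ a → z ≢ mate f x → R z (mate (exchange f a x) z)
      real′ z z≢a z≢y with exchange-view f x≢a x≢b z
      ... | at-a z≡a _          = contradiction z≡a z≢a
      ... | at-fa refl eq       = subst (R b) (sym eq) Rbx
      ... | at-x refl eq        = subst (R x) (sym eq) (R-sym Rbx)
      ... | at-fx z≡y _         = contradiction z≡y z≢y
      ... | off _ z≢b _ _ eq    = subst (R z) (sym eq) (real z z≢a z≢b)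

    -- The cycle is `u 0`, `mate p (u 0)`, `u 1`, `mate p (u 1)`, and so on, with l + 2 matching
    -- edges. Performing `near-step` along it and closing it up would produce a second perfect
    -- matching.
    no-alternating-cycle : (u : ℕ → Fin k) (l : ℕ) →
      (∀ {i j} → i < j → j ≤ suc l → u j ≢ u i × u j ≢ mate p (u i)) →
      (∀ {j} → j ≤ l → R (mate p (u j)) (u (suc j))) →
      R (mate p (u (suc l))) (u 0) → ⊥
    no-alternating-cycle u l fresh link close
      with walk (suc l) ≤-refl
      where
      walk : ∀ j → j ≤ suc l → Σ Pairing λ f → Near (u 0) (mate p (u j)) f ×
        -- Away from the visited pairs `f` still agrees with `p`; hence the next vertex `u (suc j)`
        -- still has its partner under `p`.
        (∀ z → (∀ i → i ≤ j → z ≢ u i × z ≢ mate p (u i)) → mate f z ≡ mate p z)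
      walk zero    _ = p , (refl , λ x _ _ → p-real x) , λ _ _ → refl
      walk (suc j) j<l with walk j (<⇒≤ j<l)
      ... | f , near , same = exchange f (u 0) x
          , subst (λ y → Near (u 0) y (exchange f (u 0) x)) fx≡px
                  (near-step f near (link (≤-pred j<l)) x≢u0)
          , λ z out → trans
              (exchange-off f x≢u0 x≢fu0 (proj₁ (out 0 z≤n))
                (λ eq → proj₂ (out j (n≤1+n j)) (trans eq (proj₁ near)))
                (proj₁ (out (suc j) ≤-refl))
                (λ eq → proj₂ (out (suc j) ≤-refl) (trans eq fx≡px)))
              (same z λ i i≤j → out i (m≤n⇒m≤1+n i≤j))
        where
        x = u (suc j)
        x≢u0 = proj₁ (fresh (s≤s z≤n) j<l)
        x≢fu0 : x ≢ mate f (u 0)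
        x≢fu0 eq = proj₂ (fresh (n<1+n j) j<l) (trans eq (proj₁ near))
        fx≡px : mate f x ≡ mate p x
        fx≡px = same x λ i i≤j → fresh (s≤s i≤j) j<l
    ... | f , near , _ = proj₁ (fresh (s≤s z≤n) ≤-refl)
        (sym (mate-injective p (near-closed f near (R-sym close))))

    -- Equivalently, `R` without the vertices `a` and `b` has a perfect matching: `b` is the far end
    -- of a path from `a` that alternates with `p` and begins and ends with edges of `p`.
    D : Fin k → Fin k → Set
    D a b = Σ Pairing (Near a b)

    D? : ∀ a b → Dec (D a b)
    D? a b = map′ (λ (f , f² , f≢ , near) → pairing f f² f≢ , near)
                  (λ (f , near) → mate f , mate² f , mate-≢ f , near)
                  (anyFunction? k P ext P?)
      where
      P : (Fin k → Fin k) → Set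
      P f = (∀ x → f (f x) ≡ x) × (∀ x → f x ≢ x) ×
            f a ≡ b × (∀ x → x ≢ a → x ≢ b → R x (f x))
      ext : ∀ {f g} → (∀ x → f x ≡ g x) → P f → P g
      ext {f} {g} eq (f² , f≢ , fa , real) =
        (λ x → trans (trans (sym (eq (g x))) (cong f (sym (eq x)))) (f² x)) ,
        (λ x gx≡x → f≢ x (trans (eq x) gx≡x)) ,
        trans (sym (eq a)) fa ,
        λ x x≢a x≢b → subst (R x) (eq x) (real x x≢a x≢b)
      P? : ∀ f → Dec (P f)
      P? f = all? (λ x → f (f x) ≟ᶠ x) ×-dec all? (λ x → ¬? (f x ≟ᶠ x)) ×-dec
             (f a ≟ᶠ b) ×-dec
             all? (λ x → ¬? (x ≟ᶠ a) →-dec ¬? (x ≟ᶠ b) →-dec R? x (f x))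

    D-irrefl : ∀ {a} → ¬ D a a
    D-irrefl {a} (f , fa≡a , _) = mate-≢ f a fa≡a

    D-sym : ∀ {a b} → D a b → D b a
    D-sym (f , fa≡b , real) = f , mate-sym f fa≡b , λ x x≢b x≢a → real x x≢a x≢b

    D-mate : ∀ a → D a (mate p a)
    D-mate a = p , refl , λ x _ _ → p-real x

    D-edge : ∀ {a b} → D a b → R a b → mate p a ≡ b
    D-edge (f , near) = near-closed f near

    -- From a pairing with the two virtual pairs {w, d} and {a, c}, follow f from c
    -- until the pair {a, c} can be merged with {w, d}.
    D-merge : ∀ {a o w} (f : Pairing) → Near a o f → R o w → w ≢ a → ¬ D a w →
              ∀ fuel h d c → mate h w ≡ d → mate h a ≡ c → d ≢ a →
              (∀ x → x ≢ w → x ≢ d → x ≢ a → x ≢ c → R x (mate h x)) →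
              size (λ x → ¬? (mate h x ≟ᶠ mate f x)) ≤ fuel → D a d
    D-merge {a} {o} {w} f (fa≡o , f-real) Row w≢a ¬Daw = go
      where
      go : ∀ fuel h d c → mate h w ≡ d → mate h a ≡ c → d ≢ a →
           (∀ x → x ≢ w → x ≢ d → x ≢ a → x ≢ c → R x (mate h x)) →
           size (λ x → ¬? (mate h x ≟ᶠ mate f x)) ≤ fuel → D a d
      go fuel h .(mate h w) .(mate h a) refl refl d≢a real bound = advance (c ≟ᶠ o)
        where
        d = mate h w
        c = mate h a
        a≢w = ≢-sym w≢a
        a≢d = ≢-sym d≢a
        c≢w : c ≢ w
        c≢w eq = d≢a (mate-sym h eq)
        c≢d : c ≢ d
        c≢d eq = a≢w (mate-injective h eq)
        c≢a = mate-≢ h a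
        -- Pairing `c` with `w` by an edge leaves {a, d} as the only virtual pair.
        finish : R c w → D a d
        finish Rcw = exchange h a w , exchange-a h w≢a (≢-sym c≢w) , real′
          where
          real′ : ∀ z → z ≢ a → z ≢ d → R z (mate (exchange h a w) z)
          real′ z z≢a z≢d with exchange-view h w≢a (≢-sym c≢w) z
          ... | at-a z≡a _ = contradiction z≡a z≢a
          ... | at-fa refl eq = subst (R c) (sym eq) Rcw
          ... | at-x refl eq = subst (R w) (sym eq) (R-sym Rcw)
          ... | at-fx z≡d _ = contradiction z≡d z≢d
          ... | off _ z≢c z≢w _ eq = subst (R z) (sym eq) (real z z≢w z≢d z≢a z≢c)
        -- Pairing `c` with `d` by an edge would instead leave {a, w}, which `¬Daw` excludes.
        absurd : R c d → D a w
        absurd Rcd = exchange h a d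
            , trans (exchange-a h d≢a (≢-sym c≢d)) (mate² h w) , real′
          where
          real′ : ∀ z → z ≢ a → z ≢ w → R z (mate (exchange h a d) z)
          real′ z z≢a z≢w with exchange-view h d≢a (≢-sym c≢d) z
          ... | at-a z≡a _ = contradiction z≡a z≢a
          ... | at-fa refl eq = subst (R c) (sym eq) Rcd
          ... | at-x refl eq = subst (R d) (sym eq) (R-sym Rcd)
          ... | at-fx z≡w _ = contradiction (trans z≡w (mate² h w)) z≢w
          ... | off _ z≢c z≢d _ eq = subst (R z) (sym eq) (real z z≢w z≢d z≢a z≢c)
        advance : Dec (c ≡ o) → D a d
        advance (yes c≡o) = finish (subst (λ s → R s w) (sym c≡o) Row)
        advance (no c≢o) = walk (x ≟ᶠ w) (x ≟ᶠ d)
          where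
          x = mate f c
          Rcx : R c x
          Rcx = f-real c c≢a c≢o
          x≢a : x ≢ a
          x≢a eq = c≢o (trans (sym (mate-sym f eq)) fa≡o)
          x≢c = mate-≢ f c
          walk : Dec (x ≡ w) → Dec (x ≡ d) → D a d
          walk (yes x≡w) _ = finish (subst (R c) x≡w Rcx)
          walk (no _) (yes x≡d) = contradiction (absurd (subst (R c) x≡d Rcx)) ¬Daw
          walk (no x≢w) (no x≢d) = recurse fuel bound
            where
            y = mate h x
            y≢w : y ≢ w
            y≢w eq = x≢d (sym (mate-sym h eq))
            h′ = exchange h a x
            h′-off = exchange-off h x≢a x≢c
            real′ : ∀ z → z ≢ w → z ≢ d → z ≢ a → z ≢ y → R z (mate h′ z)
            real′ z z≢w z≢d z≢a z≢y with exchange-view h x≢a x≢c z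
            ... | at-a z≡a _ = contradiction z≡a z≢a
            ... | at-fa refl eq = subst (R c) (sym eq) Rcx
            ... | at-x refl eq = subst (R x) (sym eq) (R-sym Rcx)
            ... | at-fx z≡y _ = contradiction z≡y z≢y
            ... | off _ z≢c _ _ eq = subst (R z) (sym eq) (real z z≢w z≢d z≢a z≢c)
            -- On none of the four vertices a, c, x, y touched by the exchange did `h` agree with
            -- `f`, so no agreement is lost. The vertex `c` becomes a new one, and the number of
            -- disagreements drops.
            keeps : ∀ {z} → mate h′ z ≢ mate f z → mate h z ≢ mate f z
            keeps {z} h′z≢ hz≡ = h′z≢ (trans (h′-off
              (λ { refl → c≢o (trans hz≡ fa≡o) })
              (λ { refl → x≢a (trans (sym hz≡) (mate² h a)) })
              (λ { refl → x≢a (mate-injective h (trans hz≡ (mate² f c))) })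
              (λ { refl → x≢a (mate-injective h (trans (sym (mate-sym f (sym
                            (trans (sym (mate² h x)) hz≡)))) (mate² f c))) }))
              hz≡)
            less : size (λ z → ¬? (mate h′ z ≟ᶠ mate f z)) < size (λ z → ¬? (mate h z ≟ᶠ mate f z))
            less = size-⊂ (λ z → ¬? (mate h′ z ≟ᶠ mate f z)) (λ z → ¬? (mate h z ≟ᶠ mate f z)) keeps
              (λ eq → x≢a (trans (sym eq) (mate² h a)))
              (λ neq → neq (mate-sym h′ (exchange-x h x≢a x≢c)))
            recurse : ∀ fuel → size (λ z → ¬? (mate h z ≟ᶠ mate f z)) ≤ fuel → D a d
            recurse zero     b = contradiction (≤-trans less b) λ ()
            recurse (suc n) b = go n h′ d y
              (h′-off w≢a (≢-sym c≢w) (≢-sym x≢w) (≢-sym y≢w)) (exchange-a h x≢a x≢c)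
              d≢a real′ (≤-pred (≤-trans less b))

    -- Start from the pairing behind `D w d` and declare its pair at `a` virtual as well; `D-merge`
    -- then melts the two virtual pairs into {a, d}.
    D-⊆ : ∀ {a o w} → D a o → R o w → w ≢ a → ¬ D a w → ∀ {d} → D w d → D a d
    D-⊆ {a} {o} {w} (f , near) Row w≢a ¬Daw {d} Dwd@(g , gw≡d , g-real) =
      D-merge f near Row w≢a ¬Daw (size λ x → ¬? (mate g x ≟ᶠ mate f x)) g d (mate g a) gw≡d refl
        (λ { refl → ¬Daw (D-sym Dwd) })
        (λ x x≢w x≢d _ _ → g-real x x≢w x≢d) ≤-refl

    -- By `D-edge`, an edge of `R` from `w` to a member of `D w` is the matching edge of `w`. So `o`
    -- is a witness unless {o, w} is in `p`; in that case `mate f w` is one, being another neighbour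
    -- of `w`.
    D-new : ∀ {a o w} → D a o → R o w → w ≢ a → ¬ D a w → ∃ λ e → D a e × ¬ D w e
    D-new {a} {o} {w} Dao@(f , near@(fa≡o , real)) Row w≢a ¬Daw with mate p w ≟ᶠ o
    ... | no pw≢o = o , Dao , λ Dwo → pw≢o (D-edge Dwo (R-sym Row))
    ... | yes pw≡o = mate f w , (exchange f a w , near-step f near Row w≢a) , λ Dwe →
        w≢a (mate-injective f (trans (trans (sym (D-edge Dwe Rwe)) pw≡o) (sym fa≡o)))
      where
      Rwe : R w (mate f w)
      Rwe = real w w≢a (≢-sym (R-irrefl Row))

    module _ (W : Fin k → Set) (W? : ∀ x → Dec (W x))
             (W-closed : ∀ {x y} → W x → R x y → W y)
             (W-outside : ∀ {x y} → ¬ W x → R x y → y ≡ mate p x) where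

      -- If `o` were outside `W`, so would be `mate p o`, whose only neighbour is `o`. Then `f`
      -- would have to pair these two, but it pairs `o` with `a`.
      D-in-W : ∀ {a o} → W a → D a o → W o
      D-in-W {a} {o} Wa (f , fa≡o , real) with W? o
      ... | yes Wo = Wo
      ... | no ¬Wo = contradiction (subst W (trans (sym (mate-sym f fa≡o)) fo≡po) Wa) ¬Wpo
        where
        ¬Wpo : ¬ W (mate p o)
        ¬Wpo Wpo = ¬Wo (W-closed Wpo (R-sym (p-real o)))
        fo≡po : mate f o ≡ mate p o
        fo≡po = mate-sym f (trans
          (W-outside ¬Wpo (real (mate p o) (λ { refl → ¬Wpo Wa }) (mate-≢ p o)))
          (mate² p o))

      -- An edge from D a to some w outside D a ∪ {a} makes D w a proper subset of D a, so
      -- the search ends at a b for which {b, mate p b} is the only edge leaving D b.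
      bridge : ∀ {a} → W a → ∃ λ b → W b × (∀ {o w} → D b o → R o w → w ≢ b → D b w)
      bridge {a} Wa = find (size (D? a)) Wa ≤-refl
        where
        find : ∀ fuel {a} → W a → size (D? a) ≤ fuel →
               ∃ λ b → W b × (∀ {o w} → D b o → R o w → w ≢ b → D b w)
        find fuel {a} Wa bound
          with any? (λ o → any? (λ w → D? a o ×-dec R? o w ×-dec ¬? (w ≟ᶠ a) ×-dec ¬? (D? a w)))
        find fuel {a} Wa bound | no none = a , Wa , closed
          where
          closed : ∀ {o w} → D a o → R o w → w ≢ a → D a w
          closed {o} {w} Dao Row w≢a with D? a w
          ... | yes Daw = Daw
          ... | no ¬Daw = contradiction (o , w , Dao , Row , w≢a , ¬Daw) none
        find fuel {a} Wa bound | yes (o , w , Dao , Row , w≢a , ¬Daw)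
          with D-new Dao Row w≢a ¬Daw
        ... | e , Dae , ¬Dwe = descend fuel bound
          where
          less : size (D? w) < size (D? a)
          less = size-⊂ (D? w) (D? a) (D-⊆ Dao Row w≢a ¬Daw) Dae ¬Dwe
          descend : ∀ fuel → size (D? a) ≤ fuel →
                    ∃ λ b → W b × (∀ {o w} → D b o → R o w → w ≢ b → D b w)
          descend zero    b = contradiction (≤-trans less b) λ ()
          descend (suc n) b = find n (W-closed (D-in-W Wa Dao) Row) (≤-pred (≤-trans less b))

-- Large vertex sets that span only matching edges.

module IndependentSets (k : ℕ) ⦃ k≢0 : NonZero k ⦄ where
  open CyclicOrder k
  open Pairings k

  size-∪ : ∀ {P Q : Fin k → Set} (P? : ∀ x → Dec (P x)) (Q? : ∀ x → Dec (Q x)) →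
           (∀ {x} → P x → ¬ Q x) → size P? + size Q? ≤ size (λ x → P? x ⊎-dec Q? x)
  size-∪ P? Q? disj = ≤-trans (≤-reflexive (sym (∑-+ k (ind ∘ P? ∘ v) (ind ∘ Q? ∘ v))))
    (∑-mono k λ i → pointwise (P? (v i)) (Q? (v i)) disj)
    where
    pointwise : ∀ {P Q : Set} (d : Dec P) (e : Dec Q) → (P → ¬ Q) → ind d + ind e ≤ ind (d ⊎-dec e)
    pointwise (yes p) (yes q) disj = contradiction q (disj p)
    pointwise (yes p) (no _)  _    = ≤-refl
    pointwise (no _)  (yes q) _    = ≤-refl
    pointwise (no _)  (no _)  _    = ≤-refl

  size-≤-+ : ∀ {P Q S : Fin k → Set} (P? : ∀ x → Dec (P x)) (Q? : ∀ x → Dec (Q x))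
             (S? : ∀ x → Dec (S x)) → (∀ {x} → P x → Q x ⊎ S x) → size P? ≤ size Q? + size S?
  size-≤-+ P? Q? S? cov = ≤-trans (∑-mono k λ i → pointwise (P? (v i)) (Q? (v i)) (S? (v i)) cov)
    (≤-reflexive (∑-+ k (ind ∘ Q? ∘ v) (ind ∘ S? ∘ v)))
    where
    pointwise : ∀ {P Q S : Set} (d : Dec P) (e : Dec Q) (f : Dec S) → (P → Q ⊎ S) →
                ind d ≤ ind e + ind f
    pointwise (no _)  _       _       _ = z≤n
    pointwise (yes _) (yes _) _       _ = s≤s z≤n
    pointwise (yes _) (no _)  (yes _) _ = ≤-refl
    pointwise (yes p) (no ¬q) (no ¬s) c with c p
    ... | inj₁ q = contradiction q ¬q
    ... | inj₂ s = contradiction s ¬s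

  size-empty : ∀ {P : Fin k → Set} (P? : ∀ x → Dec (P x)) → (∀ x → ¬ P x) → size P? ≡ 0
  size-empty P? none = ∑-zero k λ i _ → ind-no (P? (v i)) (none (v i))

  size-singleton : ∀ a → size (λ x → x ≟ᶠ a) ≡ 1
  size-singleton a = ∑-point a

  module Independent
    (R : Fin k → Fin k → Set) (R? : ∀ x y → Dec (R x y))
    (R-sym : ∀ {x y} → R x y → R y x) (R-irrefl : ∀ {x y} → R x y → x ≢ y)
    (p : Pairing) (p-real : ∀ x → R x (mate p x))
    (p-unique : ∀ f → (∀ x → R x (mate f x)) → ∀ x → mate f x ≡ mate p x)
    where

    -- Independence is meant up to `p`, whose edges may lie inside the set. Comparing `bound` with
    -- twice the size avoids halves.
    record IndependentIn (W : Fin k → Set) (bound : ℕ) : Set₁ where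
      field
        X       : Fin k → Set
        X?      : ∀ x → Dec (X x)
        X⊆W     : ∀ {x} → X x → W x
        large   : bound ≤ 2 * size X?
        sparse  : ∀ {x y} → X x → X y → R x y → y ≡ mate p x
    open IndependentIn public

    singleton : ∀ {W : Fin k → Set} a → W a → IndependentIn W 2
    singleton {W} a Wa = record
      { X = _≡ a ; X? = _≟ᶠ a
      ; X⊆W = λ { refl → Wa }
      ; large = ≤-reflexive (cong (2 *_) (sym (size-singleton a)))
      ; sparse = λ { refl refl Raa → contradiction refl (R-irrefl Raa) } }

    Bound : (W : Fin k → Set) → (∀ x → Dec (W x)) → Set₁
    Bound W W? = (∀ {x} → W x → W (mate p x)) → ∀ {a} → W a → IndependentIn W (size W? + 2)

    -- W splits along the bridge {b, mate p b} into E and its complement.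
    module Split
      (W : Fin k → Set) (W? : ∀ x → Dec (W x)) (W-mate : ∀ {x} → W x → W (mate p x))
      (b : Fin k) (Wb : W b)
      (E : Fin k → Set) (E? : ∀ x → Dec (E x)) (E⊆W : ∀ {x} → E x → W x)
      (b∉E : ¬ E b) (r∈E : E (mate p b))
      (E-closed : ∀ {x y} → E x → W y → R x y → y ≢ b → E y)
      (E-edge : ∀ {x} → E x → R b x → mate p b ≡ x)
      (smaller : ∀ W′ W′? → size W′? < size W? → Bound W′ W′?)
      where

      r = mate p b

      B A : Fin k → Set
      B x = E x × x ≢ r
      A x = W x × ¬ E x × x ≢ b

      B? : ∀ x → Dec (B x)
      B? x = E? x ×-dec ¬? (x ≟ᶠ r)
      A? : ∀ x → Dec (A x)
      A? x = W? x ×-dec ¬? (E? x) ×-dec ¬? (x ≟ᶠ b)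

      B-mate : ∀ {x} → B x → B (mate p x)
      B-mate {x} (Ex , x≢r) =
        E-closed Ex (W-mate (E⊆W Ex)) (p-real x) (λ eq → x≢r (sym (mate-sym p eq))) ,
        λ eq → b∉E (subst E (mate-injective p eq) Ex)

      A-mate : ∀ {x} → A x → A (mate p x)
      A-mate {x} (Wx , ¬Ex , x≢b) = W-mate Wx ,
        (λ Epx → ¬Ex (E-closed Epx Wx (R-sym (p-real x)) x≢b)) ,
        λ eq → ¬Ex (subst E (mate-sym p eq) (r∈E))

      split : ∀ {x} → W x → (E x ⊎ (W x × ¬ E x))
      split {x} Wx with E? x
      ... | yes Ex = inj₁ Ex
      ... | no ¬Ex = inj₂ (Wx , ¬Ex)

      -- The surplus 2 is available in either case: from the recursion if `B` has a vertex, and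
      -- otherwise from `r` alone. `part-A` works in the same way with `b`.
      part-B : IndependentIn E (size B? + 2)
      part-B with any? B?
      ... | no none = subst (λ c → IndependentIn E (c + 2))
                        (sym (size-empty B? λ x Bx → none (x , Bx))) (singleton r (r∈E))
      ... | yes (x , Bx) = record { IndependentIn I ; X⊆W = proj₁ ∘ X⊆W I }
        where
        I = smaller B B? (size-⊂ B? W? (E⊆W ∘ proj₁) Wb (b∉E ∘ proj₁)) B-mate Bx

      part-A : IndependentIn (λ x → W x × ¬ E x) (size A? + 2)
      part-A with any? A?
      ... | no none = subst (λ c → IndependentIn (λ x → W x × ¬ E x) (c + 2))
                        (sym (size-empty A? λ x Ax → none (x , Ax))) (singleton b (Wb , b∉E))
      ... | yes (x , Ax) = record { IndependentIn I ; X⊆W = λ Xx → let Ax = X⊆W I Xx in proj₁ Ax , proj₁ (proj₂ Ax) }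
        where
        I = smaller A A? (size-⊂ A? W? proj₁ Wb (λ Ab → proj₂ (proj₂ Ab) refl)) A-mate Ax

      -- Only the bridge joins `E` to the rest of `W`: an edge leaving `E` must end in `b`, and
      -- `E-edge` makes it the matching edge.
      cross : ∀ {x y} → E x → W y × ¬ E y → R x y → y ≡ mate p x
      cross {x} {y} Ex (Wy , ¬Ey) Rxy with y ≟ᶠ b
      ... | no y≢b = contradiction (E-closed Ex Wy Rxy y≢b) ¬Ey
      ... | yes refl = sym (mate-sym p (E-edge Ex (R-sym Rxy)))

      W-size : size W? ≤ size B? + size A? + 2
      W-size = begin
        size W?                                    ≤⟨ size-≤-+ W? E? ¬E? split ⟩
        size E? + size ¬E?
          ≤⟨ +-mono-≤ (size-≤-+ E? B? (_≟ᶠ r) rest-B) (size-≤-+ ¬E? A? (_≟ᶠ b) rest-A) ⟩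
        (size B? + size (_≟ᶠ r)) + (size A? + size (_≟ᶠ b))
          ≡⟨ cong₂ (λ s t → (size B? + s) + (size A? + t)) (size-singleton r) (size-singleton b) ⟩
        (size B? + 1) + (size A? + 1)              ≡⟨ regroup (size B?) (size A?) ⟩
        size B? + size A? + 2                      ∎
        where
        open ≤-Reasoning
        ¬E? = λ x → W? x ×-dec ¬? (E? x)
        regroup : ∀ s t → (s + 1) + (t + 1) ≡ s + t + 2
        regroup = solve-∀
        rest-B : ∀ {x} → E x → B x ⊎ x ≡ r
        rest-B {x} Ex with x ≟ᶠ r
        ... | yes x≡r = inj₂ x≡r
        ... | no x≢r  = inj₁ (Ex , x≢r)
        rest-A : ∀ {x} → W x × ¬ E x → A x ⊎ x ≡ b
        rest-A {x} (Wx , ¬Ex) with x ≟ᶠ b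
        ... | yes x≡b = inj₂ x≡b
        ... | no x≢b  = inj₁ (Wx , ¬Ex , x≢b)

      result : IndependentIn W (size W? + 2)
      result = record
        { X = λ x → X part-B x ⊎ X part-A x
        ; X? = λ x → X? part-B x ⊎-dec X? part-A x
        ; X⊆W = λ { (inj₁ Xx) → E⊆W (X⊆W part-B Xx) ; (inj₂ Xx) → proj₁ (X⊆W part-A Xx) }
        -- The ends of the bridge cost 2 vertices, but the two parts bring a surplus of 2 each, so a
        -- surplus of 2 remains.
        ; large = begin
            size W? + 2                                     ≤⟨ +-monoˡ-≤ 2 W-size ⟩
            size B? + size A? + 2 + 2                       ≡⟨ regroup (size B?) (size A?) ⟩
            (size B? + 2) + (size A? + 2)                   ≤⟨ +-mono-≤ (large part-B) (large part-A) ⟩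
            2 * size (X? part-B) + 2 * size (X? part-A)     ≡⟨ *-distribˡ-+ 2 (size (X? part-B)) _ ⟨
            2 * (size (X? part-B) + size (X? part-A))
              ≤⟨ *-monoʳ-≤ 2 (size-∪ (X? part-B) (X? part-A) disjoint) ⟩
            2 * size (λ x → X? part-B x ⊎-dec X? part-A x)  ∎
        ; sparse = λ
            { (inj₁ Xx) (inj₁ Xy) → sparse part-B Xx Xy
            ; (inj₂ Xx) (inj₂ Xy) → sparse part-A Xx Xy
            ; (inj₁ Xx) (inj₂ Xy) → cross (X⊆W part-B Xx) (X⊆W part-A Xy)
            ; (inj₂ Xx) (inj₁ Xy) Rxy →
                sym (mate-sym p (sym (cross (X⊆W part-B Xy) (X⊆W part-A Xx) (R-sym Rxy)))) } }
        where
        open ≤-Reasoning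
        regroup : ∀ s t → s + t + 2 + 2 ≡ (s + 2) + (t + 2)
        regroup = solve-∀
        disjoint : ∀ {x} → X part-B x → ¬ X part-A x
        disjoint XB XA = proj₂ (X⊆W part-A XA) (X⊆W part-B XB)

    independent : ∀ fuel (W : Fin k → Set) (W? : ∀ x → Dec (W x)) → size W? ≤ fuel → Bound W W?
    independent zero W W? bound _ Wa =
      contradiction (≤-trans (size-⊂ {λ _ → ⊥} (λ _ → no λ ()) W? (λ ()) Wa (λ ())) bound) λ ()
    independent (suc fuel) W W? bound W-mate Wa = split (bridge W W? W-closed W-outside Wa)
      where
      -- Vertices outside W keep only their matching edge.
      Rᵂ : Fin k → Fin k → Set
      Rᵂ x y = R x y × ((W x × W y) ⊎ y ≡ mate p x)

      Rᵂ-sym : ∀ {x y} → Rᵂ x y → Rᵂ y x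
      Rᵂ-sym (Rxy , inj₁ (Wx , Wy)) = R-sym Rxy , inj₁ (Wy , Wx)
      Rᵂ-sym (Rxy , inj₂ y≡px) = R-sym Rxy , inj₂ (sym (mate-sym p (sym y≡px)))

      -- Uniqueness of `p` passes to the subgraph `Rᵂ`, so a bridge can be sought inside `W` while
      -- the vertex set stays `Fin k`.
      open UniqueMatching Rᵂ (λ x y → R? x y ×-dec ((W? x ×-dec W? y) ⊎-dec (y ≟ᶠ mate p x)))
        Rᵂ-sym (R-irrefl ∘ proj₁) p (λ x → p-real x , inj₂ refl)
        (λ f real → p-unique f (proj₁ ∘ real))

      W-closed : ∀ {x y} → W x → Rᵂ x y → W y
      W-closed _  (_ , inj₁ (_ , Wy)) = Wy
      W-closed Wx (_ , inj₂ refl)     = W-mate Wx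

      W-outside : ∀ {x y} → ¬ W x → Rᵂ x y → y ≡ mate p x
      W-outside ¬Wx (_ , inj₁ (Wx , _)) = contradiction Wx ¬Wx
      W-outside _   (_ , inj₂ eq)       = eq

      split : (∃ λ b → W b × (∀ {o w} → D b o → Rᵂ o w → w ≢ b → D b w)) →
              IndependentIn W (size W? + 2)
      split (b , Wb , D-closed) = Split.result W W? W-mate b Wb (D b) (D? b) D⊆W D-irrefl (D-mate b)
        (λ Dx Wy Rxy → D-closed Dx (Rxy , inj₁ (D⊆W Dx , Wy)))
        (λ Dx Rbx → D-edge Dx (Rbx , inj₁ (Wb , D⊆W Dx)))
        (λ W′ W′? less → independent fuel W′ W′? (≤-pred (≤-trans less bound)))
        where
        D⊆W : ∀ {o} → D b o → W o
        D⊆W = D-in-W W W? W-closed W-outside Wb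

-- Adjacency in powers of the cycle, and counting deleted edges.

module CyclePower (k : ℕ) ⦃ k≢0 : NonZero k ⦄ where
  open CyclicOrder k

  Vertex Edge : Set
  Vertex = Fin k
  Edge = Vertex × Vertex

  cycle-sym : ∀ {x y} → Cycle k x y → Cycle k y x
  cycle-sym (inj₁ e)                      = inj₂ (inj₁ e)
  cycle-sym (inj₂ (inj₁ e))               = inj₁ e
  cycle-sym (inj₂ (inj₂ (inj₁ e)))        = inj₂ (inj₂ (inj₂ e))
  cycle-sym (inj₂ (inj₂ (inj₂ e)))        = inj₂ (inj₂ (inj₁ e))

  cycle? : ∀ x y → Dec (Cycle k x y)
  cycle? x y = (toℕ y ≟ suc (toℕ x)) ⊎-dec (toℕ x ≟ suc (toℕ y)) ⊎-dec
    (((suc (toℕ x) ≟ k) ×-dec (toℕ y ≟ 0)) ⊎-dec ((suc (toℕ y) ≟ k) ×-dec (toℕ x ≟ 0)))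

  module _ {G : Graph k} where
    walk-snoc : ∀ {x y z l} → Walk G x y l → G y z → Walk G x z (suc l)
    walk-snoc here       e = step e here
    walk-snoc (step d w) e = step d (walk-snoc w e)

    walk-reverse : (∀ {x y} → G x y → G y x) → ∀ {x y l} → Walk G x y l → Walk G y x l
    walk-reverse s here       = here
    walk-reverse s (step e w) = walk-snoc (walk-reverse s w) (s e)

    walk? : (∀ x y → Dec (G x y)) → ∀ l x y → Dec (Walk G x y l)
    walk? G? zero x y = map′ (λ { refl → here }) (λ { here → refl }) (x ≟ᶠ y)
    walk? G? (suc l) x y =
      map′ (λ (_ , e , w) → step e w) (λ { (step e w) → _ , e , w })
           (any? λ z → G? x z ×-dec walk? G? l z y)

  power-sym : ∀ {m x y} → Power (Cycle k) m x y → Power (Cycle k) m y x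
  power-sym (x≢y , l , l≤m , w) = ≢-sym x≢y , l , l≤m , walk-reverse cycle-sym w

  power? : ∀ m x y → Dec (Power (Cycle k) m x y)
  power? m x y = ¬? (x ≟ᶠ y) ×-dec
    map′ (λ (l , l<1+m , w) → l , ≤-pred l<1+m , w) (λ (l , l≤m , w) → l , s≤s l≤m , w)
         (anyUpTo? (λ l → walk? cycle? l x y) (suc m))

  v-suc : ∀ i → v (suc i) ≡ v (suc (toℕ (v i)))
  v-suc i = v-+-cong 1 (sym (v-toℕ (v i)))

  cycle-next : ∀ i → Cycle k (v i) (v (suc i))
  cycle-next i with m≤n⇒m<n∨m≡n (toℕ<n (v i))
  ... | inj₁ 1+x<k = inj₁ (trans (cong toℕ (v-suc i)) (toℕ-v-< 1+x<k))
  ... | inj₂ 1+x≡k = inj₂ (inj₂ (inj₁ (1+x≡k ,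
          trans (cong toℕ (v-suc i)) (trans (toℕ-v _) (trans (cong (_% k) 1+x≡k) (n%n≡0 k))))))

  cycle-neighbour : ∀ {i y} → Cycle k (v (suc i)) y → y ≡ v i ⊎ y ≡ v (suc (suc i))
  cycle-neighbour {i} {y} = cases
    where
    x = v (suc i)
    after : toℕ y % k ≡ suc (toℕ x) % k → y ≡ v (suc (suc i))
    after eq = trans (sym (v-toℕ y)) (trans (v-cong eq) (sym (v-suc (suc i))))
    before : toℕ x % k ≡ suc (toℕ y) % k → y ≡ v i
    before eq = trans (sym (v-toℕ y)) (v-+-cancel 1 (trans (sym (v-cong eq)) (v-toℕ x)))
    wrap : ∀ {s t} → suc s ≡ k → t ≡ 0 → t % k ≡ suc s % k
    wrap refl refl = trans (m<n⇒m%n≡m (s≤s z≤n)) (sym (n%n≡0 k))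
    cases : Cycle k x y → y ≡ v i ⊎ y ≡ v (suc (suc i))
    cases (inj₁ e)                        = inj₂ (after (cong (_% k) e))
    cases (inj₂ (inj₁ e))                 = inj₁ (before (cong (_% k) e))
    cases (inj₂ (inj₂ (inj₁ (1+x≡k , y≡0)))) = inj₂ (after (wrap 1+x≡k y≡0))
    cases (inj₂ (inj₂ (inj₂ (1+y≡k , x≡0)))) = inj₁ (before (wrap 1+y≡k x≡0))

  power-edge : ∀ {m} d i → 1 ≤ d → d ≤ m → d < k → Power (Cycle k) m (v i) (v (d + i))
  power-edge d i 1≤d d≤m d<k = v-≢ i 0 d 1≤d d<k , d , d≤m , go d
    where
    go : ∀ d → Walk (Cycle k) (v i) (v (d + i)) d
    go zero    = here
    go (suc d) = walk-snoc (go d) (cycle-next (d + i))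

  -- The centre is numbered `2 + i` so that the two vertices before it have natural indices as well.
  -- Walks of length two that turn back end where they began and are excluded.
  square-neighbour : ∀ {i y} → Power (Cycle k) 2 (v (2 + i)) y →
    y ≡ v i ⊎ y ≡ v (1 + i) ⊎ y ≡ v (3 + i) ⊎ y ≡ v (4 + i)
  square-neighbour (x≢y , _ , _ , here) = contradiction refl x≢y
  square-neighbour (_ , _ , _ , step e here) with cycle-neighbour e
  ... | inj₁ eq = inj₂ (inj₁ eq)
  ... | inj₂ eq = inj₂ (inj₂ (inj₁ eq))
  square-neighbour (x≢y , _ , _ , step e (step e′ here)) with cycle-neighbour e
  ... | inj₁ refl with cycle-neighbour e′
  ...   | inj₁ eq = inj₁ eq
  ...   | inj₂ eq = contradiction (sym eq) x≢y
  square-neighbour (x≢y , _ , _ , step e (step e′ here)) | inj₂ refl with cycle-neighbour e′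
  ...   | inj₁ eq = contradiction (sym eq) x≢y
  ...   | inj₂ eq = inj₂ (inj₂ (inj₂ eq))
  square-neighbour (_ , _ , s≤s (s≤s ()) , step _ (step _ (step _ _)))

  module Diagonals (g : Vertex → Vertex → ℕ) (g-sym : ∀ x y → g x y ≡ g y x) where

    -- Ordered pairs are grouped by cyclic offset, so that the edges of a power of the cycle occupy
    -- the first few and the last few groups.
    diag : ℕ → ℕ
    diag d = ∑ k (λ i → g (v i) (v (d + i)))

    ∑-diag : ∑ k (λ i → ∑ k (λ j → g (v i) (v j))) ≡ ∑ k diag
    ∑-diag = trans (∑-cong k λ i → sym (∑-cyclic (g (v i)) i)) (∑-swap k k _)

    diag-sym : ∀ c d → c + d ≡ k → diag c ≡ diag d
    diag-sym c d c+d≡k = begin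
      ∑ k (λ i → g (v i) (v (c + i)))
        ≡⟨ ∑-rotate k (λ i → g (v i) (v (c + i))) (λ i → cong₂ g (v-+k i) (v-+-cong c (v-+k i))) d ⟨
      ∑ k (λ i → g (v (i + d)) (v (c + (i + d))))
        ≡⟨ ∑-cong k (λ i → trans (cong₂ g (cong v (+-comm i d)) (wrap i)) (g-sym _ _)) ⟩
      ∑ k (λ i → g (v i) (v (d + i)))  ∎
      where
      open ≡-Reasoning
      regroup : ∀ c d i → c + (i + d) ≡ (c + d) + i
      regroup = solve-∀
      wrap : ∀ i → v (c + (i + d)) ≡ v i
      wrap i = trans (cong v (regroup c d i)) (trans (cong (λ s → v (s + i)) c+d≡k) (v-k+ i))

    -- For k ≥ 5 the offsets 1, 2, k - 2, k - 1 are distinct, and by `diag-sym` the last two repeat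
    -- the first two.
    band₂ : 5 ≤ k → 2 * (diag 1 + diag 2) ≤ ∑ k (λ i → ∑ k (λ j → g (v i) (v j)))
    band₂ 5≤k with m≤n⇒∃[o]m+o≡n 5≤k
    ... | t , 5+t≡k = begin
      2 * (diag 1 + diag 2)                                ≡⟨ regroup (diag 1) (diag 2) ⟩
      diag 1 + diag 2 + diag 2 + diag 1
        ≡⟨ cong₂ (λ a b → diag 1 + diag 2 + a + b)
             (diag-sym 2 (3 + t) 5+t≡k) (diag-sym 1 (4 + t) 5+t≡k) ⟩
      diag 1 + diag 2 + diag (3 + t) + diag (4 + t)
        ≤⟨ +-monoˡ-≤ (diag (4 + t)) (+-monoˡ-≤ (diag (3 + t)) (front t)) ⟩
      ∑ (5 + t) diag                                       ≡⟨ cong (λ s → ∑ s diag) 5+t≡k ⟩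
      ∑ k diag                                             ≡⟨ ∑-diag ⟨
      ∑ k (λ i → ∑ k (λ j → g (v i) (v j)))                ∎
      where
      open ≤-Reasoning
      regroup : ∀ a b → 2 * (a + b) ≡ a + b + b + a
      regroup = solve-∀
      front : ∀ t → diag 1 + diag 2 ≤ ∑ (3 + t) diag
      front zero    = +-monoˡ-≤ (diag 2) (m≤n+m (diag 1) (diag 0))
      front (suc t) = ≤-trans (front t) (m≤m+n _ _)

    -- The offsets 1, 2, 3 and their opposites are distinct from k = 7 on. For k = 6 the offset 3 is
    -- its own opposite, and `small-k` takes over.
    band₃ : 7 ≤ k → 2 * (diag 1 + diag 2 + diag 3) ≤ ∑ k (λ i → ∑ k (λ j → g (v i) (v j)))
    band₃ 7≤k with m≤n⇒∃[o]m+o≡n 7≤k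
    ... | t , 7+t≡k = begin
      2 * (diag 1 + diag 2 + diag 3)                       ≡⟨ regroup (diag 1) (diag 2) (diag 3) ⟩
      diag 1 + diag 2 + diag 3 + diag 3 + diag 2 + diag 1
        ≡⟨ cong₂ _+_ (cong₂ (λ a b → diag 1 + diag 2 + diag 3 + a + b)
             (diag-sym 3 (4 + t) 7+t≡k) (diag-sym 2 (5 + t) 7+t≡k)) (diag-sym 1 (6 + t) 7+t≡k) ⟩
      diag 1 + diag 2 + diag 3 + diag (4 + t) + diag (5 + t) + diag (6 + t)
        ≤⟨ +-monoˡ-≤ (diag (6 + t)) (+-monoˡ-≤ (diag (5 + t)) (+-monoˡ-≤ (diag (4 + t)) (front t))) ⟩
      ∑ (7 + t) diag                                       ≡⟨ cong (λ s → ∑ s diag) 7+t≡k ⟩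
      ∑ k diag                                             ≡⟨ ∑-diag ⟨
      ∑ k (λ i → ∑ k (λ j → g (v i) (v j)))                ∎
      where
      open ≤-Reasoning
      regroup : ∀ a b c → 2 * (a + b + c) ≡ a + b + c + c + b + a
      regroup = solve-∀
      front : ∀ t → diag 1 + diag 2 + diag 3 ≤ ∑ (4 + t) diag
      front zero    = +-monoˡ-≤ (diag 3) (+-monoˡ-≤ (diag 2) (m≤n+m (diag 1) (diag 0)))
      front (suc t) = ≤-trans (front t) (m≤m+n _ _)

  open DecMembership (≡-dec (_≟ᶠ_ {k}) (_≟ᶠ_ {k})) using (_∈?_)

  hits : List Edge → Vertex → Vertex → ℕ
  hits []            x y = 0
  hits ((a , b) ∷ L) x y = ind (x ≟ᶠ a) * ind (y ≟ᶠ b) + hits L x y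

  hits-∈ : ∀ {L x y} → (x , y) ∈ L → 1 ≤ hits L x y
  hits-∈ {_ ∷ L} {x} {y} (here refl) = ≤-trans
    (≤-reflexive (sym (cong₂ _*_ (ind-yes (x ≟ᶠ x) refl) (ind-yes (y ≟ᶠ y) refl))))
    (m≤m+n (ind (x ≟ᶠ x) * ind (y ≟ᶠ y)) (hits L x y))
  hits-∈ {_ ∷ _} {x} {y} (there e∈L) = ≤-trans (hits-∈ e∈L) (m≤n+m _ _)

  ∑-hits : ∀ L → ∑ k (λ i → ∑ k (λ j → hits L (v i) (v j))) ≡ length L
  ∑-hits []            = ∑-zero k λ _ _ → ∑-zero k λ _ _ → refl
  ∑-hits ((a , b) ∷ L) = begin
    ∑ k (λ i → ∑ k (λ j → f i * g j + h i j))        ≡⟨ ∑-cong k (λ i → ∑-+ k (λ j → f i * g j) (h i)) ⟩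
    ∑ k (λ i → ∑ k (λ j → f i * g j) + ∑ k (h i))    ≡⟨ ∑-+ k _ _ ⟩
    ∑ k (λ i → ∑ k (λ j → f i * g j)) + ∑ k (λ i → ∑ k (h i))
      ≡⟨ cong₂ _+_ (∑-cong k λ i → trans (∑-*ˡ k (f i) g) (cong (f i *_) (∑-point b))) (∑-hits L) ⟩
    ∑ k (λ i → f i * 1) + length L
      ≡⟨ cong (_+ length L) (trans (∑-cong k λ i → *-identityʳ (f i)) (∑-point a)) ⟩
    suc (length L)                                   ∎
    where
    open ≡-Reasoning
    f g : ℕ → ℕ
    f i = ind (v i ≟ᶠ a)
    g j = ind (v j ≟ᶠ b)
    h : ℕ → ℕ → ℕ
    h i j = hits L (v i) (v j)

  module Deletion {G : Graph k} (S : EdgeSet G) where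

    deleted? : ∀ x y → Dec ((x , y) ∈E S)
    deleted? x y = ((x , y) ∈? edges S) ⊎-dec ((y , x) ∈? edges S)

    del : Vertex → Vertex → ℕ
    del x y = ind (deleted? x y)

    del-sym : ∀ x y → del x y ≡ del y x
    del-sym x y = ind-cong (deleted? x y) (deleted? y x) Sum.swap Sum.swap

    -- The ordered sum meets a deleted edge in both orientations, hence the factor 2.
    ∑-del : ∑ k (λ i → ∑ k (λ j → del (v i) (v j))) ≤ 2 * card S
    ∑-del = begin
      ∑ k (λ i → ∑ k (λ j → del (v i) (v j)))
        ≤⟨ ∑-mono k (λ i → ∑-mono k (λ j → bound (v i) (v j))) ⟩
      ∑ k (λ i → ∑ k (λ j → hit i j + hit j i))
        ≡⟨ trans (∑-cong k λ i → ∑-+ k (hit i) (λ j → hit j i)) (∑-+ k _ _) ⟩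
      ∑ k (λ i → ∑ k (hit i)) + ∑ k (λ i → ∑ k (λ j → hit j i))
        ≡⟨ cong₂ _+_ (∑-hits (edges S)) (trans (∑-swap k k (λ i j → hit j i)) (∑-hits (edges S))) ⟩
      card S + card S
        ≡⟨ cong (card S +_) (+-identityʳ (card S)) ⟨
      2 * card S ∎
      where
      open ≤-Reasoning
      hit : ℕ → ℕ → ℕ
      hit i j = hits (edges S) (v i) (v j)
      bound : ∀ x y → del x y ≤ hits (edges S) x y + hits (edges S) y x
      bound x y with deleted? x y
      ... | no _           = z≤n
      ... | yes (inj₁ x,y) = ≤-trans (hits-∈ x,y) (m≤m+n _ _)
      ... | yes (inj₂ y,x) = ≤-trans (hits-∈ y,x) (m≤n+m _ _)

-- The graph left after deletion, and the lower bound for m ≥ 3.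

module LowerBound (k : ℕ) ⦃ k≢0 : NonZero k ⦄ where
  open CyclicOrder k
  open Pairings k
  open IndependentSets k
  open CyclePower k

  module AntiForcing {m : ℕ} (S : EdgeSet (Power (Cycle k) m)) (anti : IsAntiForcingSet (Power (Cycle k) m) S) where

    open Deletion S public

    R : Vertex → Vertex → Set
    R = deleteEdges (Power (Cycle k) m) S

    R? : ∀ x y → Dec (R x y)
    R? x y = power? m x y ×-dec ¬? (deleted? x y)

    R-sym : ∀ {x y} → R x y → R y x
    R-sym (e , kept) = power-sym e , λ { (inj₁ d) → kept (inj₂ d) ; (inj₂ d) → kept (inj₁ d) }

    R-irrefl : ∀ {x y} → R x y → x ≢ y
    R-irrefl ((x≢y , _) , _) = x≢y

    p : Pairing
    p = pairing (partner (proj₁ anti)) (involutive (proj₁ anti)) (noFixed (proj₁ anti))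

    p-real : ∀ x → R x (mate p x)
    p-real = isEdge (proj₁ anti)

    p-unique : ∀ f → (∀ x → R x (mate f x)) → ∀ x → mate f x ≡ mate p x
    p-unique f real = proj₂ anti record
      { partner = mate f ; involutive = mate² f ; noFixed = mate-≢ f ; isEdge = real }

    kept : ∀ {x y} → Power (Cycle k) m x y → del x y ≡ 0 → R x y
    kept {x} {y} e del≡0 = e , ind≡0⇒¬ (deleted? x y) del≡0

    open UniqueMatching R R? R-sym R-irrefl p p-real p-unique public using (no-alternating-cycle)
    open Independent R R? R-sym R-irrefl p p-real p-unique

    private
      I : IndependentIn (λ _ → ⊤) (size (λ _ → yes tt) + 2)
      I = independent _ (λ _ → ⊤) (λ _ → yes tt) ≤-refl (λ _ → tt) {v 0} tt

      adj : Vertex → Vertex → ℕ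
      adj x y = ind (power? m x y)

      χ : Vertex → ℕ
      χ x = ind (X? I x)

      α : ℕ
      α = size (X? I)

    k+2≤2α : k + 2 ≤ 2 * α
    k+2≤2α = ≤-trans (≤-reflexive (cong (_+ 2) (sym (trans (∑-const k 1) (*-identityʳ k))))) (large I)

    weight : Vertex → Vertex → ℕ
    weight x y = χ x * χ y * adj x y

    -- An adjacent pair inside the set is deleted unless it is a matching edge, and each of the α
    -- vertices lies on just one matching edge. Pairs are ordered, hence the factor 2.
    ∑-weight : ∑ k (λ i → ∑ k (λ j → weight (v i) (v j))) ≤ 2 * card S + α
    ∑-weight = begin
      ∑ k (λ i → ∑ k (λ j → weight (v i) (v j)))
        ≤⟨ ∑-mono k (λ i → ∑-mono k (λ j → pointwise (v i) (v j))) ⟩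
      ∑ k (λ i → ∑ k (λ j → del (v i) (v j) + χ (v i) * twin (v i) (v j)))
        ≡⟨ trans (∑-cong k λ i → trans (∑-+ k (λ j → del (v i) (v j)) _)
                   (cong (∑ k (λ j → del (v i) (v j)) +_)
                     (trans (∑-*ˡ k (χ (v i)) _) (cong (χ (v i) *_) (∑-point (mate p (v i)))))))
                 (∑-+ k _ _) ⟩
      ∑ k (λ i → ∑ k (λ j → del (v i) (v j))) + ∑ k (λ i → χ (v i) * 1)
        ≤⟨ +-mono-≤ ∑-del (≤-reflexive (∑-cong k λ i → *-identityʳ (χ (v i)))) ⟩
      2 * card S + α ∎
      where
      open ≤-Reasoning
      twin : Vertex → Vertex → ℕ
      twin x y = ind (y ≟ᶠ mate p x)
      pointwise : ∀ x y → weight x y ≤ del x y + χ x * twin x y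
      pointwise x y with X? I x | X? I y | power? m x y | deleted? x y | y ≟ᶠ mate p x
      ... | no _   | _      | _     | _     | _ = z≤n
      ... | yes _  | no _   | _     | _     | _ = z≤n
      ... | yes _  | yes _  | no _  | _     | _ = z≤n
      ... | yes _  | yes _  | yes _ | yes _ | _ = s≤s z≤n
      ... | yes _  | yes _  | yes _ | no _  | yes _ = s≤s z≤n
      ... | yes Xx | yes Xy | yes e | no ¬d | no ≢ = contradiction (sparse I Xx Xy (e , ¬d)) ≢

    weight-sym : ∀ x y → weight x y ≡ weight y x
    weight-sym x y = cong₂ _*_ (*-comm (χ x) (χ y))
      (ind-cong (power? m x y) (power? m y x) power-sym power-sym)

    large-k : 3 ≤ m → 7 ≤ k → k + 8 ≤ 4 * card S
    large-k 3≤m 7≤k = conclude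
      where
      open Diagonals weight weight-sym
      Y : ℕ → ℕ
      Y i = χ (v i)
      E : ℕ → ℕ
      E d = ∑ k (λ i → Y i * Y (d + i))
      E≡diag : ∀ d → 1 ≤ d → d ≤ 3 → E d ≡ diag d
      E≡diag d 1≤d d≤3 = ∑-cong k λ i → sym (trans
        (cong (Y i * Y (d + i) *_) (ind-yes (power? m _ _)
          (power-edge d i 1≤d (≤-trans d≤3 3≤m) (<-≤-trans (s≤s d≤3) (≤-trans (m≤m+n 4 3) 7≤k)))))
        (*-identityʳ _))
      e = E 1 + E 2 + E 3
      edge-count : 2 * e ≤ 2 * card S + α
      edge-count = begin
        2 * e                              ≡⟨ cong (2 *_) (cong₂ _+_ (cong₂ _+_
          (E≡diag 1 (s≤s z≤n) (s≤s z≤n)) (E≡diag 2 (s≤s z≤n) (s≤s (s≤s z≤n)))) (E≡diag 3 (s≤s z≤n) ≤-refl)) ⟩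
        2 * (diag 1 + diag 2 + diag 3)               ≤⟨ band₃ 7≤k ⟩
        ∑ k (λ i → ∑ k (λ j → weight (v i) (v j)))   ≤⟨ ∑-weight ⟩
        2 * card S + α                               ∎
        where open ≤-Reasoning
      rotate : ∀ f → (∀ {i j} → v i ≡ v j → f i ≡ f j) → ∀ c → ∑ k (λ i → f (c + i)) ≡ ∑ k f
      rotate f f-cong c = trans (∑-cong k λ i → cong f (+-comm c i))
                                (∑-rotate k f (λ i → f-cong (v-+k i)) c)
      -- Every triangle {i, i+1, i+3} with a vertices in X has at least a − 1 edges in X,
      -- and these triangles partition the edges of the cube of the cycle.
      triangles : 3 * α ≤ k + e
      triangles = begin
        3 * α   ≡⟨ regroup α ⟩
        α + α + α
          ≡⟨ cong₂ _+_ (cong (α +_) (sym (rotate Y (cong χ) 1))) (sym (rotate Y (cong χ) 3)) ⟩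
        ∑ k Y + ∑ k (λ i → Y (1 + i)) + ∑ k (λ i → Y (3 + i))
          ≡⟨ trans (∑-+ k _ _) (cong (_+ ∑ k (λ i → Y (3 + i))) (∑-+ k _ _)) ⟨
        ∑ k (λ i → Y i + Y (1 + i) + Y (3 + i))
          ≤⟨ ∑-mono k (λ i → triangle (X? I (v i)) (X? I (v (1 + i))) (X? I (v (3 + i)))) ⟩
        ∑ k (λ i → 1 + (Y i * Y (1 + i) + Y (1 + i) * Y (3 + i) + Y i * Y (3 + i)))
          ≡⟨ ∑-+ k (λ _ → 1) _ ⟩
        ∑ k (λ _ → 1) + ∑ k (λ i → Y i * Y (1 + i) + Y (1 + i) * Y (3 + i) + Y i * Y (3 + i))
          ≡⟨ cong₂ _+_ (trans (∑-const k 1) (*-identityʳ k)) (trans (∑-+ k _ _) (cong (_+ E 3) (trans (∑-+ k _ _)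
               (cong (E 1 +_) (rotate (λ i → Y i * Y (2 + i)) (λ eq → cong₂ _*_ (cong χ eq) (cong χ (v-+-cong 2 eq))) 1))))) ⟩
        k + e ∎
        where
        open ≤-Reasoning
        regroup : ∀ a → 3 * a ≡ a + a + a
        regroup = solve-∀
        triangle : ∀ {P Q T : Set} (a : Dec P) (b : Dec Q) (c : Dec T) →
          ind a + ind b + ind c ≤ 1 + (ind a * ind b + ind b * ind c + ind a * ind c)
        triangle (yes _) (yes _) (yes _) = s≤s (s≤s (s≤s z≤n))
        triangle (yes _) (yes _) (no _)  = ≤-refl
        triangle (yes _) (no _)  (yes _) = ≤-refl
        triangle (yes _) (no _)  (no _)  = ≤-refl
        triangle (no _)  (yes _) (yes _) = ≤-refl
        triangle (no _)  (yes _) (no _)  = ≤-refl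
        triangle (no _)  (no _)  (yes _) = ≤-refl
        triangle (no _)  (no _)  (no _)  = z≤n
      conclude : k + 8 ≤ 4 * card S
      -- From 12α ≤ 4k + 4e ≤ 4k + 4|S| + 2α follows 10α - 4k ≤ 4|S|, and 10α ≥ 5k + 10 even yields
      -- k + 10 ≤ 4|S|.
      conclude = ≤-trans (+-monoʳ-≤ k (m≤m+n 8 2)) (+-cancelˡ-≤ (4 * k + 2 * α) _ _ (begin
        4 * k + 2 * α + (k + 10)             ≡⟨ s₁ k α ⟩
        5 * (k + 2) + 2 * α                  ≤⟨ +-monoˡ-≤ (2 * α) (*-monoʳ-≤ 5 k+2≤2α) ⟩
        5 * (2 * α) + 2 * α                  ≡⟨ s₂ α ⟩
        4 * (3 * α)                          ≤⟨ *-monoʳ-≤ 4 triangles ⟩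
        4 * (k + e)                          ≡⟨ s₃ k e ⟩
        4 * k + 2 * (2 * e)                  ≤⟨ +-monoʳ-≤ (4 * k) (*-monoʳ-≤ 2 edge-count) ⟩
        4 * k + 2 * (2 * card S + α)         ≡⟨ s₄ k (card S) α ⟩
        4 * k + 2 * α + 4 * card S           ∎))
        where
        open ≤-Reasoning
        s₁ : ∀ k a → 4 * k + 2 * a + (k + 10) ≡ 5 * (k + 2) + 2 * a
        s₁ = solve-∀
        s₂ : ∀ a → 5 * (2 * a) + 2 * a ≡ 4 * (3 * a)
        s₂ = solve-∀
        s₃ : ∀ k e → 4 * (k + e) ≡ 4 * k + 2 * (2 * e)
        s₃ = solve-∀
        s₄ : ∀ k s a → 4 * k + 2 * (2 * s + a) ≡ 4 * k + 2 * a + 4 * s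
        s₄ = solve-∀

    -- On six vertices the power is complete, so the set spans α(α - 1) ordered pairs. With α ≥ 4 at
    -- least α edges must have been deleted, and 16 exceeds 14.
    small-k : 3 ≤ m → k ≡ 6 → k + 8 ≤ 4 * card S
    small-k 3≤m k≡6 = begin
        k + 8                 ≡⟨ cong (_+ 8) k≡6 ⟩
        14                    ≤⟨ m≤m+n 14 2 ⟩
        4 * 4                 ≤⟨ *-monoʳ-≤ 4 (≤-trans 4≤α α≤card) ⟩
        4 * card S            ∎
      where
      open ≤-Reasoning
      d<k : ∀ {d} → d < 6 → d < k
      d<k d<6 = ≤-trans d<6 (≤-reflexive (sym k≡6))
      wrap : ∀ i → v (6 + i) ≡ v i
      wrap i = trans (cong (λ n → v (n + i)) (sym k≡6)) (v-k+ i)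
      complete : ∀ {x y} → x ≢ y → Power (Cycle k) m x y
      complete {x} {y} x≢y with cover (toℕ x) y
      ... | t , t<k , refl = subst (λ s → Power (Cycle k) m s (v (t + toℕ x))) (v-toℕ x)
              (go t (λ { refl → x≢y (sym (v-toℕ x)) }) (≤-trans t<k (≤-reflexive k≡6)))
        where
        go : ∀ t → t ≢ 0 → t < 6 → Power (Cycle k) m (v (toℕ x)) (v (t + toℕ x))
        go 0 0≢0 _ = contradiction refl 0≢0
        go 1 _ _ = power-edge 1 _ (s≤s z≤n) (≤-trans (s≤s z≤n) 3≤m) (d<k (s≤s (s≤s z≤n)))
        go 2 _ _ = power-edge 2 _ (s≤s z≤n) (≤-trans (s≤s (s≤s z≤n)) 3≤m) (d<k (s≤s (s≤s (s≤s z≤n))))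
        go 3 _ _ = power-edge 3 _ (s≤s z≤n) 3≤m (d<k (s≤s (s≤s (s≤s (s≤s z≤n)))))
        -- Offsets 4 and 5 are covered backwards, as offsets 2 and 1 from the other vertex.
        go 4 _ _ = power-sym (subst (Power (Cycle k) m (v (4 + toℕ x))) (wrap (toℕ x))
          (power-edge 2 (4 + toℕ x) (s≤s z≤n) (≤-trans (s≤s (s≤s z≤n)) 3≤m) (d<k (s≤s (s≤s (s≤s z≤n))))))
        go 5 _ _ = power-sym (subst (Power (Cycle k) m (v (5 + toℕ x))) (wrap (toℕ x))
          (power-edge 1 (5 + toℕ x) (s≤s z≤n) (≤-trans (s≤s z≤n) 3≤m) (d<k (s≤s (s≤s z≤n)))))
        go (suc (suc (suc (suc (suc (suc _)))))) _ (s≤s (s≤s (s≤s (s≤s (s≤s (s≤s ()))))))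
      row : ∀ x → χ x * α ≤ ∑ k (λ j → weight x (v j)) + χ x
      row x = begin
        χ x * α                                                    ≡⟨ ∑-*ˡ k (χ x) (χ ∘ v) ⟨
        ∑ k (λ j → χ x * χ (v j))                                  ≤⟨ ∑-mono k (λ j → pointwise (v j)) ⟩
        ∑ k (λ j → weight x (v j) + χ x * ind (v j ≟ᶠ x))          ≡⟨ ∑-+ k _ _ ⟩
        ∑ k (λ j → weight x (v j)) + ∑ k (λ j → χ x * ind (v j ≟ᶠ x))
          ≡⟨ cong (∑ k (λ j → weight x (v j)) +_) (trans (∑-*ˡ k (χ x) _)
               (trans (cong (χ x *_) (∑-point x)) (*-identityʳ (χ x)))) ⟩
        ∑ k (λ j → weight x (v j)) + χ x                           ∎
        where
        pointwise : ∀ y → χ x * χ y ≤ weight x y + χ x * ind (y ≟ᶠ x)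
        pointwise y with X? I x | X? I y | y ≟ᶠ x | power? m x y
        ... | no _  | _     | _      | _     = z≤n
        ... | yes _ | no _  | _      | _     = z≤n
        ... | yes _ | yes _ | yes _  | _     = m≤n+m 1 _
        ... | yes _ | yes _ | no _   | yes _ = ≤-refl
        ... | yes _ | yes _ | no y≢x | no ¬e = contradiction (complete (≢-sym y≢x)) ¬e
      4≤α : 4 ≤ α
      4≤α = *-cancelˡ-≤ 2 (≤-trans (≤-reflexive (cong (_+ 2) (sym k≡6))) k+2≤2α)
      α≤card : α ≤ card S
      α≤card = *-cancelˡ-≤ 2 (+-cancelʳ-≤ (2 * α) _ _ (begin
        2 * α + 2 * α                                     ≡⟨ s₁ α ⟩
        α * 4                                             ≤⟨ *-monoʳ-≤ α 4≤α ⟩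
        α * α                                             ≡⟨ ∑-*ˡ k α (χ ∘ v) ⟨
        ∑ k (λ i → α * χ (v i))
          ≤⟨ ∑-mono k (λ i → ≤-trans (≤-reflexive (*-comm α (χ (v i)))) (row (v i))) ⟩
        ∑ k (λ i → ∑ k (λ j → weight (v i) (v j)) + χ (v i))  ≡⟨ ∑-+ k _ _ ⟩
        ∑ k (λ i → ∑ k (λ j → weight (v i) (v j))) + α        ≤⟨ +-monoˡ-≤ α ∑-weight ⟩
        2 * card S + α + α                                ≡⟨ s₃ (card S) α ⟩
        2 * card S + 2 * α                                ∎))
        where
        s₁ : ∀ a → 2 * a + 2 * a ≡ a * 4
        s₁ = solve-∀
        s₃ : ∀ s a → 2 * s + a + a ≡ 2 * s + 2 * a
        s₃ = solve-∀

-- Parity on an even cycle.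

module EvenCycle (k : ℕ) ⦃ k≢0 : NonZero k ⦄ (n : ℕ) (k≡2n : k ≡ dbl n) where
  open CyclicOrder k
  open Pairings k
  open CyclePower k

  par : ℕ → Bool
  par zero    = false
  par (suc i) = not (par i)

  par-dbl+ : ∀ j i → par (dbl j + i) ≡ par i
  par-dbl+ zero    i = refl
  par-dbl+ (suc j) i = trans (Bool.not-involutive _) (par-dbl+ j i)

  par-dbl : ∀ j → par (dbl j) ≡ false
  par-dbl zero    = refl
  par-dbl (suc j) = trans (Bool.not-involutive _) (par-dbl j)

  dbl≡2* : ∀ j → dbl j ≡ 2 * j
  dbl≡2* zero    = refl
  dbl≡2* (suc j) = trans (cong (suc ∘ suc) (dbl≡2* j)) (regroup j)
    where
    regroup : ∀ j → suc (suc (2 * j)) ≡ 2 * suc j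
    regroup = solve-∀

  dbl-mono-< : ∀ {i j} → i < j → suc (dbl i) < dbl j
  dbl-mono-< {zero}  (s≤s _)   = s≤s (s≤s z≤n)
  dbl-mono-< {suc i} (s≤s i<j) = s≤s (s≤s (dbl-mono-< i<j))

  dbl-injective : ∀ {i j} → dbl i ≡ dbl j → i ≡ j
  dbl-injective {i} {j} eq = *-cancelˡ-≡ i j 2 (trans (sym (dbl≡2* i)) (trans eq (dbl≡2* j)))

  dbl≢1+dbl : ∀ i j → dbl i ≢ suc (dbl j)
  dbl≢1+dbl i j eq = contradiction
    (trans (sym (par-dbl i)) (trans (cong par eq) (cong not (par-dbl j)))) λ ()

  -- Reduction modulo `k` subtracts a multiple of an even number, so parity survives the
  -- wrap-around.
  par-v : ∀ i → par (toℕ (v i)) ≡ par i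
  par-v i = begin
    par (toℕ (v i))                    ≡⟨ cong par (toℕ-v i) ⟩
    par (i % k)                        ≡⟨ par-dbl+ (i / k * n) (i % k) ⟨
    par (dbl (i / k * n) + i % k)      ≡⟨ cong par (+-comm _ (i % k)) ⟩
    par (i % k + dbl (i / k * n))      ≡⟨ cong (λ s → par (i % k + s)) even ⟩
    par (i % k + i / k * k)            ≡⟨ cong par (m≡m%n+[m/n]*n i k) ⟨
    par i                              ∎
    where
    open ≡-Reasoning
    regroup : ∀ q n → 2 * (q * n) ≡ q * (2 * n)
    regroup = solve-∀
    even : dbl (i / k * n) ≡ i / k * k
    even = trans (dbl≡2* (i / k * n)) (trans (regroup (i / k) n)
             (cong (i / k *_) (sym (trans k≡2n (dbl≡2* n)))))

  halve : ∀ t n → t < dbl n → ∃ λ j → j < n × (t ≡ dbl j ⊎ t ≡ suc (dbl j))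
  halve zero          (suc n) _ = 0 , s≤s z≤n , inj₁ refl
  halve (suc zero)    (suc n) _ = 0 , s≤s z≤n , inj₂ refl
  halve (suc (suc t)) (suc n) (s≤s (s≤s t<)) with halve t n t<
  ... | j , j<n , inj₁ refl = suc j , s≤s j<n , inj₁ refl
  ... | j , j<n , inj₂ refl = suc j , s≤s j<n , inj₂ refl

  cover₂ : ∀ c x → ∃ λ j → j < n × (x ≡ v (dbl j + c) ⊎ x ≡ v (suc (dbl j + c)))
  cover₂ c x with cover c x
  ... | t , t<k , x≡ with halve t n (≤-trans t<k (≤-reflexive k≡2n))
  ...   | j , j<n , inj₁ refl = j , j<n , inj₁ x≡
  ...   | j , j<n , inj₂ refl = j , j<n , inj₂ x≡

  -- `flip` is the matching {c, c + 1}, {c + 2, c + 3}, ... around the cycle. With c = 0 it is the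
  -- forced matching of the upper bound; with c = 1 + z it consists of the diagonals of the ladder.
  module Flip (c : ℕ) where
    private
      f : Vertex → Vertex
      f x with par (toℕ x) Bool.≟ par c
      ... | yes _ = v (suc (toℕ x))
      -- Going `k ∸ 1` steps forward is one step back.
      ... | no _  = v (k ∸ 1 + toℕ x)

      f-up : ∀ j → f (v (dbl j + c)) ≡ v (suc (dbl j + c))
      f-up j with par (toℕ (v (dbl j + c))) Bool.≟ par c
      ... | yes _  = sym (v-suc (dbl j + c))
      ... | no neq = contradiction (trans (par-v (dbl j + c)) (par-dbl+ j c)) neq

      f-down : ∀ j → f (v (suc (dbl j + c))) ≡ v (dbl j + c)
      f-down j with par (toℕ (v (suc (dbl j + c)))) Bool.≟ par c
      ... | yes eq = contradiction (trans (sym eq) (trans (par-v (suc (dbl j + c)))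
                       (cong not (par-dbl+ j c)))) (Bool.not-¬ refl)
      ... | no _   = begin
        v (k ∸ 1 + toℕ (v (suc (dbl j + c))))  ≡⟨ v-+-cong (k ∸ 1) (v-toℕ _) ⟩
        v (k ∸ 1 + suc (dbl j + c))            ≡⟨ cong v (+-suc (k ∸ 1) (dbl j + c)) ⟩
        v (suc (k ∸ 1) + (dbl j + c))          ≡⟨ cong (λ s → v (s + (dbl j + c))) (suc-pred k) ⟩
        v (k + (dbl j + c))                    ≡⟨ v-k+ (dbl j + c) ⟩
        v (dbl j + c)                          ∎
        where open ≡-Reasoning

      1<k : ∀ {j} → j < n → 1 < k
      1<k j<n = ≤-trans (dbl-mono-< (≤-<-trans z≤n j<n)) (≤-reflexive (sym k≡2n))

      f² : ∀ x → f (f x) ≡ x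
      f² x with cover₂ c x
      ... | j , _ , inj₁ refl = trans (cong f (f-up j)) (f-down j)
      ... | j , _ , inj₂ refl = trans (cong f (f-down j)) (f-up j)

      f-≢ : ∀ x → f x ≢ x
      f-≢ x with cover₂ c x
      ... | j , j<n , inj₁ refl = λ eq → v-≢ (dbl j + c) 0 1 (s≤s z≤n) (1<k j<n) (trans (sym eq) (f-up j))
      ... | j , j<n , inj₂ refl = λ eq → v-≢ (dbl j + c) 0 1 (s≤s z≤n) (1<k j<n) (trans (sym (f-down j)) eq)

    flip : Pairing
    flip = pairing f f² f-≢

    flip-up : ∀ j → mate flip (v (dbl j + c)) ≡ v (suc (dbl j + c))
    flip-up = f-up

    flip-down : ∀ j → mate flip (v (suc (dbl j + c))) ≡ v (dbl j + c)
    flip-down = f-down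

  hits-∉ : ∀ L {x y} → ¬ (x , y) ∈ L → hits L x y ≡ 0
  hits-∉ []            ∉L = refl
  hits-∉ ((a , b) ∷ L) {x} {y} ∉L with x ≟ᶠ a | y ≟ᶠ b
  ... | yes refl | yes refl = contradiction (here refl) ∉L
  ... | yes _    | no _     = hits-∉ L (∉L ∘ there)
  ... | no _     | _        = hits-∉ L (∉L ∘ there)

  hits-unique : ∀ {L} → U.Unique L → ∀ x y → hits L x y ≤ 1
  hits-unique []                      x y = z≤n
  hits-unique {(a , b) ∷ L} (e∉L ∷ u) x y with x ≟ᶠ a | y ≟ᶠ b
  ... | yes refl | yes refl = ≤-reflexive (cong suc (hits-∉ L λ e∈L → All.lookup e∉L e∈L refl))
  ... | yes _    | no _     = hits-unique u x y
  ... | no _     | _        = hits-unique u x y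

  -- The upper bound.

  module Upper (m : ℕ) (1≤m : 1 ≤ m) where
    open Flip 0

    G : Graph k
    G = Power (Cycle k) m

    Q : Edge → Set
    Q (x , y) = par (toℕ x) ≡ true × toℕ x < toℕ y × G x y

    Q? : ∀ e → Dec (Q e)
    Q? (x , y) = (par (toℕ x) Bool.≟ true) ×-dec (toℕ x <? toℕ y) ×-dec power? m x y

    pairs list : List Edge
    pairs = cartesianProduct (allFin k) (allFin k)
    list  = filter Q? pairs

    ∈-list⁻ : ∀ {e} → e ∈ list → Q e
    ∈-list⁻ = proj₂ ∘ ∈-filter⁻ Q? {xs = pairs}

    ∈-list⁺ : ∀ {e} → Q e → e ∈ list
    ∈-list⁺ {x , y} = ∈-filter⁺ Q? (∈-cartesianProduct⁺ (∈-allFin x) (∈-allFin y))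

    list-unique : U.Unique list
    list-unique = filter⁺ Q? (cartesianProduct⁺ (allFin⁺ k) (allFin⁺ k))

    S : EdgeSet G
    S = record
      { edges   = list
      ; ordered = All.map (proj₁ ∘ proj₂) (All.all-filter Q? pairs)
      ; inG     = All.map (proj₂ ∘ proj₂) (All.all-filter Q? pairs)
      ; unique  = list-unique }

    even<k : ∀ {j} → j < n → suc (dbl j) < k
    even<k j<n = ≤-trans (dbl-mono-< j<n) (≤-reflexive (sym k≡2n))

    +0 : ∀ j → v (dbl j + 0) ≡ v (dbl j)
    +0 j = cong v (+-identityʳ (dbl j))

    1+0 : ∀ j → v (suc (dbl j + 0)) ≡ v (suc (dbl j))
    1+0 j = cong (v ∘ suc) (+-identityʳ (dbl j))

    toℕ-even : ∀ {j} → j < n → toℕ (v (dbl j)) ≡ dbl j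
    toℕ-even j<n = toℕ-v-< (<-trans (n<1+n _) (even<k j<n))

    toℕ-odd : ∀ {j} → j < n → toℕ (v (suc (dbl j))) ≡ suc (dbl j)
    toℕ-odd j<n = toℕ-v-< (even<k j<n)

    R : Graph k
    R = deleteEdges G S

    rung : ∀ {j} → j < n → R (v (dbl j)) (v (suc (dbl j)))
    rung {j} j<n = power-edge 1 (dbl j) ≤-refl 1≤m (≤-<-trans (s≤s z≤n) (even<k j<n)) , λ
      { (inj₁ d) → contradiction (trans (sym (proj₁ (∈-list⁻ d)))
                     (trans (cong par (toℕ-even j<n)) (par-dbl j))) λ ()
      ; (inj₂ d) → <-asym (n<1+n (dbl j))
                     (subst₂ _<_ (toℕ-odd j<n) (toℕ-even j<n) (proj₁ (proj₂ (∈-list⁻ d)))) }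

    flip-real : ∀ x → R x (mate flip x)
    flip-real x with cover₂ 0 x
    ... | j , j<n , inj₁ refl = subst₂ R (sym (+0 j)) (sym (trans (flip-up j) (1+0 j))) (rung j<n)
    ... | j , j<n , inj₂ refl =
      let (e , kept) = rung j<n in
      subst₂ R (sym (1+0 j)) (sym (trans (flip-down j) (+0 j)))
        (power-sym e , λ { (inj₁ d) → kept (inj₂ d) ; (inj₂ d) → kept (inj₁ d) })

    module _ (M : PerfectMatching R) where
      private
        q = partner M

      lower : ∀ {x} → par (toℕ x) ≡ true → toℕ (q x) < toℕ x
      lower {x} odd with <-cmp (toℕ (q x)) (toℕ x)
      ... | tri< qx<x _ _ = qx<x
      ... | tri≈ _ qx≡x _ = contradiction (toℕ-injective qx≡x) (noFixed M x)
      ... | tri> _ _ x<qx = contradiction (inj₁ (∈-list⁺ (odd , x<qx , proj₁ (isEdge M x))))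
                                          (proj₂ (isEdge M x))

      -- Strong induction on `j`. By `lower` the partner of an odd vertex has a smaller number, and
      -- every smaller vertex except `v (dbl j)` already belongs to an earlier pair.
      forced : ∀ fuel j → j < fuel → j < n → q (v (suc (dbl j))) ≡ v (dbl j)
      forced (suc fuel) j j<fuel j<n with cover₂ 0 (q (v (suc (dbl j))))
      ... | i , i<n , inj₁ qx≡ = earlier (m≤n⇒m<n∨m≡n i≤j)
        where
        x = v (suc (dbl j))
        qx≡e : q x ≡ v (dbl i)
        qx≡e = trans qx≡ (+0 i)
        less : dbl i < suc (dbl j)
        less = subst₂ _<_ (trans (cong toℕ qx≡e) (toℕ-even i<n)) (toℕ-odd j<n)
                 (lower (trans (par-v (suc (dbl j))) (cong not (par-dbl j))))
        i≤j : i ≤ j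
        i≤j = *-cancelˡ-≤ 2 (subst₂ _≤_ (dbl≡2* i) (dbl≡2* j) (≤-pred less))
        earlier : i < j ⊎ i ≡ j → q x ≡ v (dbl j)
        earlier (inj₂ refl) = qx≡e
        earlier (inj₁ i<j)  = contradiction (dbl-injective (suc-injective (begin
            suc (dbl i)              ≡⟨ toℕ-odd i<n ⟨
            toℕ (v (suc (dbl i)))    ≡⟨ cong toℕ (trans (sym (involutive M _)) (cong q IH)) ⟩
            toℕ (q (v (dbl i)))      ≡⟨ cong toℕ (trans (cong q (sym qx≡e)) (involutive M x)) ⟩
            toℕ x                    ≡⟨ toℕ-odd j<n ⟩
            suc (dbl j)              ∎))) (<⇒≢ i<j)
          where
          open ≡-Reasoning
          IH = forced fuel i (<-≤-trans i<j (≤-pred j<fuel)) i<n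
      ... | i , i<n , inj₂ qx≡ = contradiction (begin
            dbl i                    ≡⟨ toℕ-even i<n ⟨
            toℕ (v (dbl i))          ≡⟨ cong toℕ IH ⟨
            toℕ (q (v (suc (dbl i))))  ≡⟨ cong toℕ (trans (cong q (sym qx≡o)) (involutive M x)) ⟩
            toℕ x                    ≡⟨ toℕ-odd j<n ⟩
            suc (dbl j)              ∎) (dbl≢1+dbl i j)
        where
        open ≡-Reasoning
        x = v (suc (dbl j))
        qx≡o : q x ≡ v (suc (dbl i))
        qx≡o = trans qx≡ (1+0 i)
        less : suc (dbl i) < suc (dbl j)
        less = subst₂ _<_ (trans (cong toℕ qx≡o) (toℕ-odd i<n)) (toℕ-odd j<n)
                 (lower (trans (par-v (suc (dbl j))) (cong not (par-dbl j))))
        i<j : i < j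
        i<j = *-cancelˡ-< 2 i j (subst₂ _<_ (dbl≡2* i) (dbl≡2* j) (≤-pred less))
        IH = forced fuel i (<-≤-trans i<j (≤-pred j<fuel)) i<n

      agree : ∀ x → q x ≡ mate flip x
      agree x with cover₂ 0 x
      ... | j , j<n , inj₂ refl =
        trans (cong q (1+0 j)) (trans (forced n j j<n j<n) (sym (trans (flip-down j) (+0 j))))
      ... | j , j<n , inj₁ refl =
        trans (cong q (trans (+0 j) (sym (forced n j j<n j<n))))
          (trans (involutive M _) (sym (trans (flip-up j) (1+0 j))))

    antiForcing : IsAntiForcingSet G S
    antiForcing = record { partner = mate flip ; involutive = mate² flip
                         ; noFixed = mate-≢ flip ; isEdge = flip-real } , agree

    odd : ℕ → ℕ
    odd i = ind (par i Bool.≟ true)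

    ∑-restrict : ∀ (f : ℕ → ℕ) k {j} → j ≤ k → ∑ k (λ i → f i * ind (i <? j)) ≡ ∑ j f
    ∑-restrict f k {j} j≤k with m≤n⇒m<n∨m≡n j≤k
    ... | inj₂ refl = ∑-cong-< k λ i i<k →
          trans (cong (f i *_) (ind-yes (i <? k) i<k)) (*-identityʳ (f i))
    ∑-restrict f (suc k) {j} _ | inj₁ (s≤s j≤k) =
      trans (cong₂ _+_ (∑-restrict f k j≤k)
              (trans (cong (f k *_) (ind-no (k <? j) (≤⇒≯ j≤k))) (*-zeroʳ (f k))))
            (+-identityʳ (∑ j f))

    odd-dbl : ∀ j → odd (dbl j) ≡ 0
    odd-dbl j = ind-no (par (dbl j) Bool.≟ true) λ eq → contradiction (trans (sym (par-dbl j)) eq) λ ()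

    ∑-odd : ∀ j → ∑ (dbl j) odd ≡ j
    ∑-odd zero    = refl
    ∑-odd (suc j) = begin
      ∑ (dbl j) odd + odd (dbl j) + odd (suc (dbl j))
        ≡⟨ cong₂ _+_ (cong₂ _+_ (∑-odd j) (odd-dbl j))
             (ind-yes (par (suc (dbl j)) Bool.≟ true) (cong not (par-dbl j))) ⟩
      j + 0 + 1   ≡⟨ regroup j ⟩
      suc j       ∎
      where
      open ≡-Reasoning
      regroup : ∀ j → j + 0 + 1 ≡ suc j
      regroup = solve-∀

    -- Count deleted edges at their larger end: the vertices 2j and 2j + 1 both have exactly j
    -- smaller odd vertices.
    card-S : card S ≤ ∑ n (λ j → j + j)
    card-S = begin
      card S                                            ≡⟨ ∑-hits list ⟨
      ∑ k (λ i → ∑ k (λ j → hits list (v i) (v j)))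
        ≤⟨ ∑-mono-< k (λ i i<k → ∑-mono-< k (λ j j<k → pointwise i<k j<k)) ⟩
      ∑ k (λ i → ∑ k (λ j → odd i * ind (i <? j)))      ≡⟨ ∑-swap k k _ ⟩
      ∑ k (λ j → ∑ k (λ i → odd i * ind (i <? j)))
        ≡⟨ ∑-cong-< k (λ j j<k → ∑-restrict odd k (<⇒≤ j<k)) ⟩
      ∑ k (λ j → ∑ j odd)                               ≡⟨ cong (λ s → ∑ s (λ j → ∑ j odd)) k≡2n ⟩
      ∑ (dbl n) (λ j → ∑ j odd)                         ≡⟨ ∑-even-odd n (λ j → ∑ j odd) ⟩
      ∑ n (λ j → ∑ (dbl j) odd + (∑ (dbl j) odd + odd (dbl j)))
        ≡⟨ ∑-cong n (λ j → cong₂ _+_ (∑-odd j)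
             (trans (cong₂ _+_ (∑-odd j) (odd-dbl j)) (+-identityʳ j))) ⟩
      ∑ n (λ j → j + j)                                 ∎
      where
      open ≤-Reasoning
      pointwise : ∀ {i j} → i < k → j < k → hits list (v i) (v j) ≤ odd i * ind (i <? j)
      pointwise {i} {j} i<k j<k with par i Bool.≟ true | i <? j
      ... | yes _ | yes _   = hits-unique list-unique (v i) (v j)
      ... | yes _ | no i≮j  = ≤-reflexive (hits-∉ list λ e →
              i≮j (subst₂ _<_ (toℕ-v-< i<k) (toℕ-v-< j<k) (proj₁ (proj₂ (∈-list⁻ e)))))
      ... | no even | _     = ≤-reflexive (hits-∉ list λ e →
              even (trans (cong par (sym (toℕ-v-< i<k))) (proj₁ (∈-list⁻ e))))

    upper : 4 * card S ≤ k * (k ∸ 2)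
    upper = ≤-trans (*-monoʳ-≤ 4 card-S)
      (≤-reflexive (trans (closed n) (cong (λ k → k * (k ∸ 2)) (sym k≡2n))))
      where
      gauss : ∀ n → ∑ (suc n) (λ j → j + j) ≡ suc n * n
      gauss zero    = refl
      gauss (suc n) = trans (cong (_+ (suc n + suc n)) (gauss n)) (regroup n)
        where
        regroup : ∀ n → suc n * n + (suc n + suc n) ≡ suc (suc n) * suc n
        regroup = solve-∀
      closed : ∀ n → 4 * ∑ n (λ j → j + j) ≡ dbl n * (dbl n ∸ 2)
      closed zero    = refl
      closed (suc n) = trans (cong (4 *_) (gauss n)) (trans (regroup n)
        (sym (cong₂ _*_ (dbl≡2* (suc n)) (dbl≡2* n))))
        where
        regroup : ∀ n → 4 * (suc n * n) ≡ 2 * suc n * (2 * n)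
        regroup = solve-∀

-- The lower bound for m = 2: the square as a circular ladder.

module SquareOfCycle (k : ℕ) ⦃ k≢0 : NonZero k ⦄ (n : ℕ) (k≡2n : k ≡ dbl n) (6≤k : 6 ≤ k) where
  open CyclicOrder k
  open Pairings k
  open CyclePower k
  open LowerBound k
  open EvenCycle k n k≡2n

  -- Six consecutive vertices are distinct. The bounds on `a` and `b` are settled by evaluation
  -- wherever both are literals.
  apart : ∀ a b i {_ : True (a <? b)} {_ : True (b <? 6)} → v (a + i) ≢ v (b + i)
  apart a b i {a<b} {b<6} =
    v-≢ i a b (toWitness a<b) (≤-trans (≤-trans (toWitness b<6) 6≤k) (m≤n+m k a))

  ∑₂ : ℕ → (ℕ → ℕ) → ℕ
  ∑₂ z f = ∑ n (λ j → f (dbl j + z))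

  Periodic : (ℕ → ℕ) → Set
  Periodic f = ∀ {i j} → v i ≡ v j → f i ≡ f j

  v-dbl-n : ∀ i → v (dbl n + i) ≡ v i
  v-dbl-n i = trans (cong (λ s → v (s + i)) (sym k≡2n)) (v-k+ i)

  ∑₂-shift : ∀ {f} → Periodic f → ∀ z → ∑ n (λ j → f (2 + (dbl j + z))) ≡ ∑₂ z f
  ∑₂-shift {f} per z = ∑-shift n (λ j → f (dbl j + z)) (per (v-dbl-n z))

  -- `∑₂` visits every second vertex for one whole turn, so moving its start by an even number of
  -- steps only permutes the terms.
  ∑₂-rebase : ∀ {f} → Periodic f → ∀ c z → ∑₂ (dbl c + z) f ≡ ∑₂ z f
  ∑₂-rebase per zero z = refl
  ∑₂-rebase {f} per (suc c) z = trans
    (∑-cong n λ j → cong f (trans (+-suc (dbl j) _) (cong suc (+-suc (dbl j) _))))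
    (trans (∑₂-shift per (dbl c + z)) (∑₂-rebase per c z))

  module Square (S : EdgeSet (Power (Cycle k) 2)) (anti : IsAntiForcingSet (Power (Cycle k) 2) S) where
    open AntiForcing S anti

    M : ℕ → ℕ → Set
    M i j = mate p (v i) ≡ v j

    M-sym : ∀ {i j} → M i j → M j i
    M-sym = mate-sym p

    M-functional : ∀ {i j j′} → M i j → M i j′ → v j ≡ v j′
    M-functional e e′ = trans (sym e) e′

    neighbour : ∀ i → M (2 + i) i ⊎ M (2 + i) (1 + i) ⊎ M (2 + i) (3 + i) ⊎ M (2 + i) (4 + i)
    neighbour i = square-neighbour (proj₁ (p-real (v (2 + i))))

    -- Sep i: no matching edge crosses the gap between v (1 + i) and v (2 + i).
    Link Sep Even : ℕ → Set
    Link i = M i (2 + i) × M (1 + i) (3 + i)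
    Sep  i = ¬ M i (2 + i) × ¬ M (1 + i) (2 + i) × ¬ M (1 + i) (3 + i)
    Even i = Link i ⊎ Sep i

    Link? : ∀ i → Dec (Link i)
    Link? i = (mate p (v i) ≟ᶠ v (2 + i)) ×-dec (mate p (v (1 + i)) ≟ᶠ v (3 + i))

    link⇒sep : ∀ {i} → Link i → Sep (2 + i)
    link⇒sep {i} (e , e′) =
      (λ h → apart 0 4 i (M-functional (M-sym e) h)) ,
      (λ h → apart 1 4 i (M-functional (M-sym e′) h)) ,
      (λ h → apart 1 5 i (M-functional (M-sym e′) h))

    -- Behind an uncrossed gap, `v (2 + i)` can only be matched forwards, to `3 + i` or `4 + i`. In
    -- the second case `v (3 + i)` is left with `5 + i` alone, which completes a link.
    sep⇒ : ∀ {i} → Sep i → (M (2 + i) (3 + i) × Sep (2 + i)) ⊎ Link (2 + i)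
    sep⇒ {i} (¬02 , ¬12 , ¬13) with neighbour i
    ... | inj₁ h = contradiction (M-sym h) ¬02
    ... | inj₂ (inj₁ h) = contradiction (M-sym h) ¬12
    ... | inj₂ (inj₂ (inj₁ h)) = inj₁ (h ,
            (λ h′ → apart 3 4 i (M-functional h h′)) ,
            (λ h′ → apart 2 4 i (M-functional (M-sym h) h′)) ,
            (λ h′ → apart 2 5 i (M-functional (M-sym h) h′)))
    ... | inj₂ (inj₂ (inj₂ h)) with neighbour (1 + i)
    ...   | inj₁ h′ = contradiction (M-sym h′) ¬13
    ...   | inj₂ (inj₁ h′) = contradiction (M-functional (M-sym h′) h) (apart 3 4 i)
    ...   | inj₂ (inj₂ (inj₁ h′)) = contradiction (M-functional (M-sym h) (M-sym h′)) (apart 2 3 i)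
    ...   | inj₂ (inj₂ (inj₂ h′)) = inj₂ (h , h′)

    even-step : ∀ {i} → Even i → Even (2 + i)
    even-step (inj₁ l) = inj₂ (link⇒sep l)
    even-step (inj₂ s) with sep⇒ s
    ... | inj₁ (_ , s′) = inj₂ s′
    ... | inj₂ l        = inj₁ l

    even-all : ∀ {z} → Even z → ∀ j → Even (dbl j + z)
    even-all e zero    = e
    even-all e (suc j) = even-step (even-all e j)

    -- Index 0 or 1 works, depending on the partners of the vertices 1 and 2.
    even-start : ∃ Even
    even-start = go (M? 1 2) (M? 2 4) (M? 1 3)
      where
      M? : ∀ i j → Dec (M i j)
      M? i j = mate p (v i) ≟ᶠ v j
      go : Dec (M 1 2) → Dec (M 2 4) → Dec (M 1 3) → ∃ Even
      go (yes h) _ _ = 1 , inj₂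
        ( (λ h′ → apart 2 3 0 (M-functional h h′))
        , (λ h′ → apart 1 3 0 (M-functional (M-sym h) h′))
        , (λ h′ → apart 1 4 0 (M-functional (M-sym h) h′)))
      go (no _) (yes h) (yes h′) = 1 , inj₁ (h′ , h)
      go (no ¬12) (yes h) (no ¬13) = 0 , inj₂
        ( (λ h′ → apart 0 4 0 (M-functional (M-sym h′) h)) , ¬12 , ¬13)
      go (no ¬12) (no ¬24) (yes h) with neighbour 0
      ... | inj₁ h′ = 0 , inj₁ (M-sym h′ , h)
      ... | inj₂ (inj₁ h′) = contradiction (M-sym h′) ¬12
      ... | inj₂ (inj₂ (inj₁ h′)) = contradiction (M-functional (M-sym h) (M-sym h′)) (apart 1 2 0)
      ... | inj₂ (inj₂ (inj₂ h′)) = contradiction h′ ¬24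
      go (no ¬12) (no ¬24) (no ¬13) with M? 2 3
      ... | no ¬23 = 1 , inj₂ (¬13 , ¬23 , ¬24)
      ... | yes h = 0 , inj₂ ((λ h′ → apart 0 3 0 (M-functional (M-sym h′) h)) , ¬12 , ¬13)

    d₁ d₂ ℓ : ℕ → ℕ
    d₁ i = del (v i) (v (1 + i))
    d₂ i = del (v i) (v (2 + i))
    ℓ i = ind (Link? i)

    d₁-per : Periodic d₁
    d₁-per eq = cong₂ del eq (v-+-cong 1 eq)

    d₂-per : Periodic d₂
    d₂-per eq = cong₂ del eq (v-+-cong 2 eq)

    ℓ-per : Periodic ℓ
    ℓ-per {i} {j} eq = ind-cong (Link? i) (Link? j) (transfer eq) (transfer (sym eq))
      where
      transfer : ∀ {i j} → v i ≡ v j → Link i → Link j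
      transfer eq (e , e′) =
        trans (cong (mate p) (sym eq)) (trans e (v-+-cong 2 eq)) ,
        trans (cong (mate p) (sym (v-+-cong 1 eq))) (trans e′ (v-+-cong 3 eq))

    -- Links at `i` and `2 + i` would both claim the vertex `v (2 + i)`.
    ℓ-exclusive : ∀ i → ℓ i + ℓ (2 + i) ≤ 1
    ℓ-exclusive i with Link? i | Link? (2 + i)
    ... | no _  | d     = ind-≤1 d
    ... | yes _ | no _  = ≤-refl
    ... | yes l | yes (h , _) = contradiction h (proj₁ (link⇒sep l))

    edge₁ : ∀ i → d₁ i ≡ 0 → R (v i) (v (1 + i))
    edge₁ i = kept (power-edge 1 i (s≤s z≤n) (s≤s z≤n) (≤-trans (s≤s (s≤s z≤n)) 6≤k))

    edge₂ : ∀ i → d₂ i ≡ 0 → R (v i) (v (2 + i))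
    edge₂ i = kept (power-edge 2 i (s≤s z≤n) ≤-refl (≤-trans (s≤s (s≤s (s≤s z≤n))) 6≤k))

    -- This and the next two lemmas cover alternating cycles with two, three and four matching
    -- edges. Only the first vertex of each matching edge has to be compared with the earlier edges.
    cycle₂ : ∀ {a a′ b b′} → mate p a ≡ a′ → mate p b ≡ b′ → R a′ b → R b′ a →
             b ≢ a → b ≢ a′ → ⊥
    cycle₂ {a} {b = b} refl refl ab ba b≢a b≢a′ = no-alternating-cycle u 0
      (λ { {zero} {suc zero} _ _ → b≢a , b≢a′
         ; {suc _} {suc zero} (s≤s ()) _ ; {_} {suc (suc _)} _ (s≤s ()) })
      (λ { z≤n → ab }) ba
      where
      u : ℕ → Vertex
      u zero    = a
      u (suc _) = b

    cycle₃ : ∀ {a a′ b b′ c c′} → mate p a ≡ a′ → mate p b ≡ b′ → mate p c ≡ c′ →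
             R a′ b → R b′ c → R c′ a →
             b ≢ a × b ≢ a′ → c ≢ a × c ≢ a′ → c ≢ b × c ≢ b′ → ⊥
    cycle₃ {a} {b = b} {c = c} refl refl refl ab bc ca b≢a c≢a c≢b = no-alternating-cycle u 1
      (λ { {0} {1} _ _ → b≢a ; {0} {2} _ _ → c≢a ; {1} {2} _ _ → c≢b
         ; {suc _} {1} (s≤s ()) _ ; {suc (suc _)} {2} (s≤s (s≤s ())) _
         ; {_} {suc (suc (suc _))} _ (s≤s (s≤s ())) })
      (λ { {0} _ → ab ; {1} _ → bc ; {suc (suc _)} (s≤s ()) }) ca
      where
      u : ℕ → Vertex
      u 0             = a
      u 1             = b
      u (suc (suc _)) = c

    cycle₄ : ∀ {a a′ b b′ c c′ d d′} →
             mate p a ≡ a′ → mate p b ≡ b′ → mate p c ≡ c′ → mate p d ≡ d′ →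
             R a′ b → R b′ c → R c′ d → R d′ a →
             b ≢ a × b ≢ a′ → c ≢ a × c ≢ a′ → c ≢ b × c ≢ b′ →
             d ≢ a × d ≢ a′ → d ≢ b × d ≢ b′ → d ≢ c × d ≢ c′ → ⊥
    cycle₄ {a} {b = b} {c = c} {d = d} refl refl refl refl ab bc cd da b≢a c≢a c≢b d≢a d≢b d≢c =
      no-alternating-cycle u 2
      (λ { {0} {1} _ _ → b≢a ; {0} {2} _ _ → c≢a ; {1} {2} _ _ → c≢b
         ; {0} {3} _ _ → d≢a ; {1} {3} _ _ → d≢b ; {2} {3} _ _ → d≢c
         ; {suc _} {1} (s≤s ()) _ ; {suc (suc _)} {2} (s≤s (s≤s ())) _
         ; {suc (suc (suc _))} {3} (s≤s (s≤s (s≤s ()))) _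
         ; {_} {suc (suc (suc (suc _)))} _ (s≤s (s≤s (s≤s ()))) })
      (λ { {0} _ → ab ; {1} _ → bc ; {2} _ → cd ; {suc (suc (suc _))} (s≤s (s≤s ())) }) da
      where
      u : ℕ → Vertex
      u 0                   = a
      u 1                   = b
      u 2                   = c
      u (suc (suc (suc _))) = d

    pair≢ : ∀ {x y z : Vertex} → y ≢ x → z ≢ x → x ≢ y × x ≢ z
    pair≢ f g = ≢-sym f , ≢-sym g

    -- The two rails of a link and the rungs at its two ends form an alternating four-cycle.
    inner : ∀ i → Link i → 1 ≤ d₁ i + d₁ (2 + i)
    inner i (h , h′) = n≢0⇒n>0 λ sum≡0 → cycle₂ h (M-sym h′)
      (edge₁ (2 + i) (m+n≡0⇒n≡0 (d₁ i) sum≡0))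
      (R-sym (edge₁ i (m+n≡0⇒m≡0 (d₁ i) sum≡0)))
      (≢-sym (apart 0 3 i)) (≢-sym (apart 2 3 i))

    module _ (i : ℕ) (rt : d₂ (2 + i) ≡ 0) (su : d₂ (3 + i) ≡ 0) where
      private
        r~t = edge₂ (2 + i) rt
        u~s = R-sym (edge₂ (3 + i) su)

      rung-rung : M (2 + i) (3 + i) → M (4 + i) (5 + i) → ⊥
      rung-rung h h′ = cycle₂ (M-sym h) h′ r~t u~s (≢-sym (apart 3 4 i)) (≢-sym (apart 2 4 i))

      -- The rung {2 + i, 3 + i} is not in the matching here, so the cycle goes back along the rails
      -- of the link and crosses over on the rung at `i`.
      link-rung : Link i → d₁ i ≡ 0 → M (4 + i) (5 + i) → ⊥
      link-rung (h , h′) κ h″ = cycle₃ (M-sym h′) h h″ (R-sym (edge₁ i κ)) r~t u~s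
        (apart 0 3 i , apart 0 1 i)
        (pair≢ (apart 3 4 i) (apart 1 4 i))
        (pair≢ (apart 0 4 i) (apart 2 4 i))

      rung-link : M (2 + i) (3 + i) → Link (4 + i) → d₁ (6 + i) ≡ 0 → ⊥
      rung-link h (h′ , h″) κ = cycle₃ (M-sym h) h′ (M-sym h″) r~t (edge₁ (6 + i) κ) u~s
        (pair≢ (apart 1 2 (2 + i)) (apart 0 2 (2 + i)))
        (pair≢ (apart 1 5 (2 + i)) (apart 0 5 (2 + i)))
        (pair≢ (apart 2 5 (2 + i)) (apart 4 5 (2 + i)))

      -- For k = 6 the eight indices wrap around; v (7 + i) is still distinct from
      -- v i and v (1 + i) because their mates are.
      link-link : Link i → d₁ i ≡ 0 → Link (4 + i) → d₁ (6 + i) ≡ 0 → ⊥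
      link-link (h , h′) κ (g , g′) κ′ =
        cycle₄ (M-sym h′) h g (M-sym g′) (R-sym (edge₁ i κ)) r~t (edge₁ (6 + i) κ′) u~s
        (apart 0 3 i , apart 0 1 i)
        (pair≢ (apart 3 4 i) (apart 1 4 i))
        (pair≢ (apart 0 4 i) (apart 2 4 i))
        (≢-sym (apart 1 5 (2 + i)) ,
          λ eq → apart 3 5 i (M-functional h′ (trans (cong (mate p) (sym eq)) (M-sym g′))))
        ((λ eq → apart 2 5 i (M-functional h (trans (cong (mate p) (sym eq)) (M-sym g′)))) ,
          ≢-sym (apart 0 5 (2 + i)))
        (pair≢ (apart 2 5 (2 + i)) (apart 4 5 (2 + i)))

    -- One of the edges of the alternating cycle around the gap between the rungs at 2 + i
    -- and 4 + i is deleted; the cycle runs through the adjacent links, if there are any.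
    cross : ∀ i → Even i → 1 ≤ d₂ (2 + i) + d₂ (3 + i) + ℓ i * d₁ i + ℓ (4 + i) * d₁ (6 + i) + ℓ (2 + i)
    cross i even = n≢0⇒n>0 λ sum≡0 →
      let zero₄ = m+n≡0⇒m≡0 _ sum≡0
          ℓ₂≡0  = m+n≡0⇒n≡0 (d₂ (2 + i) + d₂ (3 + i) + ℓ i * d₁ i + ℓ (4 + i) * d₁ (6 + i)) sum≡0
          zero₃ = m+n≡0⇒m≡0 _ zero₄
          ℓκ₄   = m+n≡0⇒n≡0 (d₂ (2 + i) + d₂ (3 + i) + ℓ i * d₁ i) zero₄
          zero₂ = m+n≡0⇒m≡0 _ zero₃
          ℓκ₀   = m+n≡0⇒n≡0 (d₂ (2 + i) + d₂ (3 + i)) zero₃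
      in go (m+n≡0⇒m≡0 _ zero₂) (m+n≡0⇒n≡0 (d₂ (2 + i)) zero₂) ℓκ₀ ℓκ₄ (ind≡0⇒¬ (Link? (2 + i)) ℓ₂≡0) even
      where
      unlink : ∀ {j c} → ℓ j * c ≡ 0 → Link j → c ≡ 0
      unlink {j} {c} eq l = trans (sym (*-identityˡ c))
        (trans (cong (_* c) (sym (ind-yes (Link? j) l))) eq)
      right : Sep (2 + i) → M (4 + i) (5 + i) ⊎ Link (4 + i)
      right s with sep⇒ s
      ... | inj₁ (h , _) = inj₁ h
      ... | inj₂ l       = inj₂ l
      go : d₂ (2 + i) ≡ 0 → d₂ (3 + i) ≡ 0 → ℓ i * d₁ i ≡ 0 → ℓ (4 + i) * d₁ (6 + i) ≡ 0 →
           ¬ Link (2 + i) → Even i → ⊥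
      go rt su κ₀ κ₄ ¬l (inj₁ l) with right (link⇒sep l)
      ... | inj₁ h  = link-rung i rt su l (unlink κ₀ l) h
      ... | inj₂ l′ = link-link i rt su l (unlink κ₀ l) l′ (unlink κ₄ l′)
      go rt su κ₀ κ₄ ¬l (inj₂ s) with sep⇒ s
      ... | inj₂ l = ¬l l
      ... | inj₁ (h , s′) with right s′
      ...   | inj₁ h′ = rung-rung i rt su h h′
      ...   | inj₂ l′ = rung-link i rt su h l′ (unlink κ₄ l′)

    -- An alternating cycle that winds once around the ladder, with matching edges from `a j` to
    -- `b j`. The offsets increase and stay below `k`, which makes all its vertices distinct.
    track : (a b : ℕ → ℕ) (z l : ℕ) →
      (∀ {j} → j ≤ suc l → M (a j + z) (b j + z)) →
      (∀ {j} → j ≤ suc l → a j < b j) → (∀ {j} → j ≤ l → b j < a (suc j)) →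
      (∀ {j} → j ≤ suc l → b j < k) →
      (∀ {j} → j ≤ l → R (v (b j + z)) (v (a (suc j) + z))) →
      R (v (b (suc l) + z)) (v (a 0 + z)) → ⊥
    track a b z l match a<b b<a b<k link close = no-alternating-cycle (λ j → v (a j + z)) l
      (λ {i} {j} i<j j≤l → let bi<aj = ascending i<j j≤l
                               ai<bi = a<b (<⇒≤ (<-≤-trans i<j j≤l))
                               aj<k  = <-trans (a<b j≤l) (b<k j≤l)
                           in
        ≢-sym (v-≢ z (a i) (a j) (<-trans ai<bi bi<aj) (≤-trans aj<k (m≤n+m k (a i)))) ,
        λ eq → v-≢ z (b i) (a j) bi<aj (≤-trans aj<k (m≤n+m k (b i)))
                 (sym (trans eq (match (<⇒≤ (<-≤-trans i<j j≤l))))))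
      (λ {j} j≤l → subst (λ x → R x (v (a (suc j) + z))) (sym (match (m≤n⇒m≤1+n j≤l))) (link j≤l))
      (subst (λ x → R x (v (a 0 + z))) (sym (match ≤-refl)) close)
      where
      ascending : ∀ {i j} → i < j → j ≤ suc l → b i < a j
      ascending {i} {suc j} i<1+j (s≤s j≤l) with m≤n⇒m<n∨m≡n (≤-pred i<1+j)
      ... | inj₂ refl = b<a j≤l
      ... | inj₁ i<j  = <-trans (ascending i<j (m≤n⇒m≤1+n j≤l))
                          (<-trans (a<b (m≤n⇒m≤1+n j≤l)) (b<a j≤l))

    -- Where `Even i` holds, this indicates that the rung {2 + i, 3 + i} is in the matching:
    -- otherwise it is covered by a link at `i` or at `2 + i`.
    δ : ℕ → ℕ
    δ i = 1 ∸ (ℓ i + ℓ (2 + i))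

    δ-per : Periodic δ
    δ-per eq = cong (1 ∸_) (cong₂ _+_ (ℓ-per eq) (ℓ-per (v-+-cong 2 eq)))

    sep⇒link : ∀ {i} → Sep i → δ i ≡ 0 → Link (2 + i)
    sep⇒link {i} s δ≡0 with Link? i | Link? (2 + i)
    ... | _     | yes l = l
    ... | yes l | no _  = contradiction (proj₁ l) (proj₁ s)
    ... | no _  | no _  = contradiction δ≡0 λ ()

    module Base (z : ℕ) (even : Even z) where

      -- Deleted rungs, even rails, odd rails and diagonals, and the number of links.
      K RT SU ST q : ℕ
      K  = ∑₂ z d₁
      RT = ∑₂ z d₂
      SU = ∑₂ z (d₂ ∘ suc)
      ST = ∑₂ z (d₁ ∘ suc)
      q  = ∑₂ z ℓ

      -- Offsets 1 and 2, each split by the parity of the first vertex, give four disjoint classes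
      -- of edges; `band₂` and `∑-del` count all of them twice.
      total : K + RT + (ST + SU) ≤ card S
      total = *-cancelˡ-≤ 2 (begin
        2 * (K + RT + (ST + SU))                 ≡⟨ cong (2 *_) collect ⟨
        2 * ∑ k (λ i → d₁ i + d₂ i)              ≡⟨ cong (2 *_) (∑-+ k d₁ d₂) ⟩
        2 * (∑ k d₁ + ∑ k d₂)                    ≤⟨ Diagonals.band₂ del del-sym (≤-trans (n≤1+n 5) 6≤k) ⟩
        ∑ k (λ i → ∑ k (λ j → del (v i) (v j)))  ≤⟨ ∑-del ⟩
        2 * card S                               ∎)
        where
        open ≤-Reasoning
        F : ℕ → ℕ
        F i = d₁ i + d₂ i
        collect : ∑ k F ≡ K + RT + (ST + SU)
        collect = trans (sym (∑-rotate k F (λ i → cong₂ _+_ (d₁-per (v-+k i)) (d₂-per (v-+k i))) z))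
          (trans (cong (λ s → ∑ s (λ i → F (i + z))) k≡2n)
          (trans (∑-even-odd n (λ i → F (i + z)))
          (trans (∑-+ n (λ j → F (dbl j + z)) (λ j → F (suc (dbl j + z))))
                 (cong₂ _+_ (∑-+ n _ _) (∑-+ n _ _)))))

      -- A rung may be the right end of one link or the left end of the next, but by `ℓ-exclusive`
      -- not both.
      charge : ∑ n (λ j → ℓ (dbl j + z) * d₁ (dbl j + z)) + ∑ n (λ j → ℓ (dbl j + z) * d₁ (2 + (dbl j + z))) ≤ K
      charge = begin
        ∑ n (λ j → ℓ (dbl j + z) * d₁ (dbl j + z)) + ∑ n (λ j → ℓ (dbl j + z) * d₁ (2 + (dbl j + z)))
          ≡⟨ cong (_+ ∑ n (λ j → ℓ (dbl j + z) * d₁ (2 + (dbl j + z))))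
               (∑₂-shift {λ i → ℓ i * d₁ i} (λ eq → cong₂ _*_ (ℓ-per eq) (d₁-per eq)) z) ⟨
        ∑ n (λ j → ℓ (2 + (dbl j + z)) * d₁ (2 + (dbl j + z))) + ∑ n (λ j → ℓ (dbl j + z) * d₁ (2 + (dbl j + z)))
          ≡⟨ ∑-+ n _ _ ⟨
        ∑ n (λ j → ℓ (2 + (dbl j + z)) * d₁ (2 + (dbl j + z)) + ℓ (dbl j + z) * d₁ (2 + (dbl j + z)))
          ≤⟨ ∑-mono n (λ j → pointwise (dbl j + z)) ⟩
        ∑ n (λ j → d₁ (2 + (dbl j + z)))
          ≡⟨ ∑₂-shift {d₁} d₁-per z ⟩
        K ∎
        where
        open ≤-Reasoning
        pointwise : ∀ i → ℓ (2 + i) * d₁ (2 + i) + ℓ i * d₁ (2 + i) ≤ d₁ (2 + i)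
        pointwise i = begin
          ℓ (2 + i) * d₁ (2 + i) + ℓ i * d₁ (2 + i)  ≡⟨ *-distribʳ-+ (d₁ (2 + i)) (ℓ (2 + i)) (ℓ i) ⟨
          (ℓ (2 + i) + ℓ i) * d₁ (2 + i)
            ≤⟨ *-monoˡ-≤ (d₁ (2 + i)) (≤-trans (≤-reflexive (+-comm (ℓ (2 + i)) (ℓ i))) (ℓ-exclusive i)) ⟩
          1 * d₁ (2 + i)                             ≡⟨ *-identityˡ _ ⟩
          d₁ (2 + i)                                 ∎

      -- By `inner` every link has a deleted rung at one of its ends, and by `charge` no rung serves
      -- two links.
      q≤K : q ≤ K
      q≤K = ≤-trans (∑-mono n λ j → pointwise (dbl j + z)) (≤-trans (≤-reflexive (∑-+ n _ _)) charge)
        where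
        pointwise : ∀ i → ℓ i ≤ ℓ i * d₁ i + ℓ i * d₁ (2 + i)
        pointwise i with Link? i
        ... | no _  = z≤n
        ... | yes l = ≤-trans (inner i l)
                        (≤-reflexive (sym (cong₂ _+_ (*-identityˡ (d₁ i)) (*-identityˡ (d₁ (2 + i))))))

      -- Sum `cross` over all gaps; the two terms for neighbouring links are moved to a common index
      -- and absorbed by `charge`.
      n≤ : n ≤ RT + SU + K + q
      n≤ = begin
        n                      ≡⟨ trans (∑-const n 1) (*-identityʳ n) ⟨
        ∑ n (λ _ → 1)          ≤⟨ ∑-mono n (λ j → cross (dbl j + z) (even-all even j)) ⟩
        ∑ n (λ j → rt j + su j + a j + b j + c j)
          ≡⟨ trans (∑-+ n _ c) (cong (_+ ∑ n c) (trans (∑-+ n _ b) (cong (_+ ∑ n b)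
               (trans (∑-+ n _ a) (cong (_+ ∑ n a) (∑-+ n rt su)))))) ⟩
        ∑ n rt + ∑ n su + ∑ n a + ∑ n b + ∑ n c
          ≡⟨ cong₂ _+_ (cong₂ _+_ (cong (_+ ∑ n a) (cong₂ _+_ (∑₂-shift {d₂} d₂-per z) (∑₂-shift {d₂ ∘ suc} (λ eq → d₂-per (v-+-cong 1 eq)) z)))
               shift-b) (∑₂-shift {ℓ} ℓ-per z) ⟩
        RT + SU + ∑ n a + ∑ n b′ + q   ≡⟨ cong (_+ q) (+-assoc (RT + SU) (∑ n a) (∑ n b′)) ⟩
        RT + SU + (∑ n a + ∑ n b′) + q ≤⟨ +-monoˡ-≤ q (+-monoʳ-≤ (RT + SU) charge) ⟩
        RT + SU + K + q                ∎
        where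
        open ≤-Reasoning
        rt su a b b′ c : ℕ → ℕ
        rt j = d₂ (2 + (dbl j + z))
        su j = d₂ (3 + (dbl j + z))
        a j = ℓ (dbl j + z) * d₁ (dbl j + z)
        b j = ℓ (4 + (dbl j + z)) * d₁ (6 + (dbl j + z))
        b′ j = ℓ (dbl j + z) * d₁ (2 + (dbl j + z))
        c j = ℓ (2 + (dbl j + z))
        B : ℕ → ℕ
        B i = ℓ i * d₁ (2 + i)
        B-per : Periodic B
        B-per eq = cong₂ _*_ (ℓ-per eq) (d₁-per (v-+-cong 2 eq))
        shift-b : ∑ n b ≡ ∑ n b′
        shift-b = trans (∑₂-shift {λ i → B (2 + i)} (λ eq → B-per (v-+-cong 2 eq)) z) (∑₂-shift {B} B-per z)

      -- If all diagonals survived, they would form a perfect matching of `R`, hence the matching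
      -- itself, which `Even z` rules out.
      1≤ST : 1 ≤ ST
      1≤ST = n≢0⇒n>0 λ ST≡0 → go (p-unique flip (real ST≡0) (v (1 + z))) even
        where
        open Flip (1 + z)
        diagonal : ST ≡ 0 → ∀ {j} → j < n → R (v (dbl j + (1 + z))) (v (suc (dbl j + (1 + z))))
        diagonal ST≡0 {j} j<n = edge₁ _ (trans (cong d₁ (+-suc (dbl j) z))
          (∑≡0⇒ n (λ j → d₁ (suc (dbl j + z))) ST≡0 j<n))
        real : ST ≡ 0 → ∀ x → R x (mate flip x)
        real ST≡0 x with cover₂ (1 + z) x
        ... | j , j<n , inj₁ refl = subst (R _) (sym (flip-up j)) (diagonal ST≡0 j<n)
        ... | j , j<n , inj₂ refl = subst (R _) (sym (flip-down j)) (R-sym (diagonal ST≡0 j<n))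
        go : mate flip (v (1 + z)) ≡ mate p (v (1 + z)) → Even z → ⊥
        go eq (inj₁ (_ , h)) = apart 2 3 z (trans (sym (flip-up 0)) (trans eq h))
        go eq (inj₂ (_ , ¬h , _)) = ¬h (trans (sym eq) (flip-up 0))

      -- `n≤` and `1≤ST` give n - q + 1 ≤ |S|, and q ≤ (n - 2)/2 turns the left side into at least
      -- n/2 + 2 = (k + 8)/4.
      many-rungs : 2 + (q + q) ≤ n → k + 8 ≤ 4 * card S
      many-rungs 2+2q≤n = +-cancelʳ-≤ (4 * q) _ _ (begin
        k + 8 + 4 * q                          ≡⟨ cong (λ s → s + 8 + 4 * q) (trans k≡2n (dbl≡2* n)) ⟩
        2 * n + 8 + 4 * q                      ≡⟨ s₁ n q ⟩
        2 * n + 2 * (2 + (q + q)) + 4          ≤⟨ +-monoˡ-≤ 4 (+-monoʳ-≤ (2 * n) (*-monoʳ-≤ 2 2+2q≤n)) ⟩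
        2 * n + 2 * n + 4                      ≡⟨ s₂ n ⟩
        4 * (n + 1)                            ≤⟨ *-monoʳ-≤ 4 (+-mono-≤ n≤ 1≤ST) ⟩
        4 * (RT + SU + K + q + ST)             ≡⟨ s₃ RT SU K q ST ⟩
        4 * (K + RT + (ST + SU)) + 4 * q       ≤⟨ +-monoˡ-≤ (4 * q) (*-monoʳ-≤ 4 total) ⟩
        4 * card S + 4 * q                     ∎)
        where
        open ≤-Reasoning
        s₁ : ∀ n q → 2 * n + 8 + 4 * q ≡ 2 * n + 2 * (2 + (q + q)) + 4
        s₁ = solve-∀
        s₂ : ∀ n → 2 * n + 2 * n + 4 ≡ 4 * (n + 1)
        s₂ = solve-∀
        s₃ : ∀ r s k q t → 4 * (r + s + k + q + t) ≡ 4 * (k + r + (t + s)) + 4 * q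
        s₃ = solve-∀

      -- `δ` is what the two link terms lack to reach 1, and over a full turn every link is met
      -- twice.
      count : q + q + ∑₂ z δ ≡ n
      count = begin
        q + q + ∑₂ z δ
          ≡⟨ cong (λ s → q + s + ∑₂ z δ) (∑₂-shift {ℓ} ℓ-per z) ⟨
        q + ∑ n (λ j → ℓ (2 + (dbl j + z))) + ∑₂ z δ
          ≡⟨ trans (∑-+ n _ _) (cong (_+ ∑₂ z δ) (∑-+ n _ _)) ⟨
        ∑ n (λ j → ℓ (dbl j + z) + ℓ (2 + (dbl j + z)) + δ (dbl j + z))
          ≡⟨ ∑-cong n (λ j → m+[n∸m]≡n (ℓ-exclusive (dbl j + z))) ⟩
        ∑ n (λ _ → 1)
          ≡⟨ trans (∑-const n 1) (*-identityʳ n) ⟩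
        n ∎
        where open ≡-Reasoning

      -- The l + 2 links stand at z, z + 4, z + 8, ... and fill the ladder.
      module NoRungs (link : Link z) (δ≡0 : ∀ {j} → j < n → δ (dbl j + z) ≡ 0)
                     (l : ℕ) (n≡ : n ≡ dbl (2 + l)) where

        links : ∀ t → t ≤ suc l → Link (dbl (dbl t) + z)
        links zero    _     = link
        links (suc t) t<1+l = sep⇒link (link⇒sep (links t (<⇒≤ t<1+l)))
          (δ≡0 (≤-trans (dbl-mono-< (m<n⇒m<1+n t<1+l)) (≤-reflexive (sym n≡))))

        wrap : ∀ c → v (c + (dbl (dbl (2 + l)) + z)) ≡ v (c + z)
        wrap c = v-+-cong c (trans (cong (λ s → v (dbl s + z)) (sym n≡)) (v-dbl-n z))

        <k : ∀ {t} → t ≤ suc l → 3 + dbl (dbl t) < k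
        <k t≤ = ≤-trans (dbl-mono-< (dbl-mono-< (s≤s t≤))) (≤-reflexive (sym (trans k≡2n (cong dbl n≡))))

        unlinked : ∀ {t} → t ≤ suc l → suc (dbl t) < n
        unlinked t≤ = ≤-trans (dbl-mono-< (s≤s t≤)) (≤-reflexive (sym n≡))

        -- The even rails, by turns inside a link and between two links, form one alternating cycle.
        -- `1≤SU` does the same for the odd rails.
        1≤RT : 1 ≤ RT
        1≤RT = n≢0⇒n>0 λ RT≡0 → track (dbl ∘ dbl) (λ t → 2 + dbl (dbl t)) z l
          (λ {t} t≤ → proj₁ (links t t≤)) (λ _ → s≤s (n≤1+n _)) (λ _ → s≤s (s≤s (s≤s (n≤1+n _))))
          (λ t≤ → <-trans (n<1+n _) (<k t≤))
          (λ {t} t≤ → edge₂ (2 + dbl (dbl t) + z) (rail RT≡0 (m≤n⇒m≤1+n t≤)))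
          (subst (R _) (wrap 0) (edge₂ (2 + dbl (dbl (suc l)) + z) (rail RT≡0 ≤-refl)))
          where
          rail : RT ≡ 0 → ∀ {t} → t ≤ suc l → d₂ (2 + dbl (dbl t) + z) ≡ 0
          rail RT≡0 t≤ = ∑≡0⇒ n (λ j → d₂ (dbl j + z)) RT≡0 (unlinked t≤)

        1≤SU : 1 ≤ SU
        1≤SU = n≢0⇒n>0 λ SU≡0 → track (suc ∘ dbl ∘ dbl) (λ t → 3 + dbl (dbl t)) z l
          (λ {t} t≤ → proj₂ (links t t≤)) (λ _ → s≤s (s≤s (n≤1+n _))) (λ _ → s≤s (s≤s (s≤s (s≤s (n≤1+n _)))))
          <k
          (λ {t} t≤ → edge₂ (3 + dbl (dbl t) + z) (rail SU≡0 (m≤n⇒m≤1+n t≤)))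
          (subst (R _) (wrap 1) (edge₂ (3 + dbl (dbl (suc l)) + z) (rail SU≡0 ≤-refl)))
          where
          rail : SU ≡ 0 → ∀ {t} → t ≤ suc l → d₂ (3 + dbl (dbl t) + z) ≡ 0
          rail SU≡0 t≤ = ∑≡0⇒ n (λ j → d₂ (suc (dbl j + z))) SU≡0 (unlinked t≤)

        bound : q + q ≡ n → k + 8 ≤ 4 * card S
        bound q+q≡n = begin
          k + 8                          ≡⟨ cong (_+ 8) (trans k≡2n (trans (dbl≡2* n) (cong (2 *_) (sym q+q≡n)))) ⟩
          2 * (q + q) + 8                ≡⟨ s₁ q ⟩
          4 * (q + 1 + (0 + 1))          ≤⟨ *-monoʳ-≤ 4 (+-mono-≤ (+-mono-≤ q≤K 1≤RT) (+-mono-≤ z≤n 1≤SU)) ⟩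
          4 * (K + RT + (ST + SU))       ≤⟨ *-monoʳ-≤ 4 total ⟩
          4 * card S                     ∎
          where
          open ≤-Reasoning
          s₁ : ∀ q → 2 * (q + q) + 8 ≡ 4 * (q + 1 + (0 + 1))
          s₁ = solve-∀

      -- After the only rung the links follow at z + 2, z + 6, .... The condition on `δ` stops short
      -- of the last position, whose value records the rung at `z` itself.
      module OneRung (rung : M z (1 + z)) (sep : Sep z) (l : ℕ) (n≡ : n ≡ 3 + dbl l)
                     (δ≡0 : ∀ {j} → j < 2 + dbl l → δ (dbl j + z) ≡ 0) where

        N = 2 + dbl l

        rt su st : ℕ → ℕ
        rt j = d₂ (dbl j + z)
        su j = d₂ (suc (dbl j + z))
        st j = d₁ (suc (dbl j + z))

        dbl<N : ∀ {t} → t ≤ l → suc (dbl t) < N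
        dbl<N t≤l = dbl-mono-< (s≤s t≤l)

        links : ∀ t → t ≤ l → Link (2 + dbl (dbl t) + z)
        links zero    _   = sep⇒link sep (δ≡0 (s≤s z≤n))
        links (suc t) t<l = sep⇒link (link⇒sep (links t (<⇒≤ t<l)))
          (δ≡0 (s≤s (s≤s (<-trans (n<1+n _) (dbl-mono-< t<l)))))

        wrap : ∀ c → v (c + (6 + dbl (dbl l) + z)) ≡ v (c + z)
        wrap c = v-+-cong c (trans (cong (λ s → v (dbl s + z)) (sym n≡)) (v-dbl-n z))

        <k : ∀ {t} → t ≤ l → 5 + dbl (dbl t) < k
        <k t≤l = ≤-trans (dbl-mono-< (s≤s (dbl<N t≤l))) (≤-reflexive (sym (trans k≡2n (cong dbl n≡))))

        -- Across the rung, over the first diagonal to the even rails, and along these around the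
        -- ladder back to `v z`.
        even-track : 1 ≤ st 0 + ∑ N (rt ∘ suc)
        even-track = n≢0⇒n>0 λ sum≡0 →
          let st₀ = m+n≡0⇒m≡0 (st 0) sum≡0
              rail : ∀ {t} → t ≤ l → rt (2 + dbl t) ≡ 0
              rail t≤l = ∑≡0⇒ N (rt ∘ suc) (m+n≡0⇒n≡0 (st 0) sum≡0) (dbl<N t≤l)
          in track a b z l
            (λ { {zero} _ → rung ; {suc t} (s≤s t≤l) → proj₁ (links t t≤l) })
            (λ { {zero} _ → ≤-refl ; {suc t} _ → s≤s (s≤s (s≤s (n≤1+n _))) })
            (λ { {zero} _ → ≤-refl ; {suc t} _ → s≤s (s≤s (s≤s (s≤s (s≤s (n≤1+n _))))) })
            (λ { {zero} _ → ≤-trans (s≤s (s≤s z≤n)) 6≤k ; {suc t} (s≤s t≤l) → <-trans (n<1+n _) (<k t≤l) })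
            (λ { {zero} _ → edge₁ (1 + z) st₀
               ; {suc t} t<l → edge₂ (4 + dbl (dbl t) + z) (rail (<⇒≤ t<l)) })
            (subst (R _) (wrap 0) (edge₂ (4 + dbl (dbl l) + z) (rail ≤-refl)))
          where
          a b : ℕ → ℕ
          a zero    = 0
          a (suc t) = 2 + dbl (dbl t)
          b zero    = 1
          b (suc t) = 4 + dbl (dbl t)

        -- Across the rung, along the odd rails around the ladder, and over the last diagonal back
        -- to `v z`.
        odd-track : 1 ≤ ∑ N su + st N
        odd-track = n≢0⇒n>0 λ sum≡0 →
          let stₙ = m+n≡0⇒n≡0 (∑ N su) sum≡0
              rail : ∀ {j} → j < N → su j ≡ 0
              rail = ∑≡0⇒ N su (m+n≡0⇒m≡0 (∑ N su) sum≡0)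
          in track a b z l
            (λ { {zero} _ → rung ; {suc t} (s≤s t≤l) → proj₂ (links t t≤l) })
            (λ { {zero} _ → ≤-refl ; {suc t} _ → s≤s (s≤s (s≤s (s≤s (n≤1+n _)))) })
            (λ { {zero} _ → s≤s (s≤s z≤n) ; {suc t} _ → s≤s (s≤s (s≤s (s≤s (s≤s (s≤s (n≤1+n _)))))) })
            (λ { {zero} _ → ≤-trans (s≤s (s≤s z≤n)) 6≤k ; {suc t} (s≤s t≤l) → <k t≤l })
            (λ { {zero} _ → edge₂ (1 + z) (rail (s≤s z≤n))
               ; {suc t} t<l → edge₂ (5 + dbl (dbl t) + z)
                   (rail (s≤s (s≤s (<-trans (n<1+n _) (dbl-mono-< t<l))))) })
            (subst (R _) (wrap 0) (edge₁ (5 + dbl (dbl l) + z) stₙ))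
          where
          a b : ℕ → ℕ
          a zero    = 0
          a (suc t) = 3 + dbl (dbl t)
          b zero    = 1
          b (suc t) = 5 + dbl (dbl t)

        -- The pairs {2j + 1, 2j + 2}, with {−1, 0}, {1, 2} replaced by {0, 2}, {−1, 1}.
        twisted : 1 ≤ rt 0 + ∑ (suc (dbl l)) (st ∘ suc) + su N
        twisted = n≢0⇒n>0 λ sum≡0 →
          let rt+st≡0 = m+n≡0⇒m≡0 (rt 0 + ∑ (suc (dbl l)) (st ∘ suc)) sum≡0
          in absurd (m+n≡0⇒m≡0 (rt 0) rt+st≡0)
               (∑≡0⇒ (suc (dbl l)) (st ∘ suc) (m+n≡0⇒n≡0 (rt 0) rt+st≡0))
               (m+n≡0⇒n≡0 (rt 0 + ∑ (suc (dbl l)) (st ∘ suc)) sum≡0)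
          where
          open Flip (1 + z)
          a x y : Vertex
          a = v (1 + z)
          x = v z
          y = v (dbl N + (1 + z))
          x≡ : v (suc (dbl N + (1 + z))) ≡ x
          x≡ = trans (cong (v ∘ suc) (+-suc (dbl N) z)) (wrap 0)
          fa≡ : mate flip a ≡ v (2 + z)
          fa≡ = flip-up 0
          fx≡ : mate flip x ≡ y
          fx≡ = trans (cong (mate flip) (sym x≡)) (flip-down N)
          x≢a : x ≢ a
          x≢a = apart 0 1 z
          x≢fa : x ≢ mate flip a
          x≢fa eq = apart 0 2 z (trans eq fa≡)
          module _ (rt₀ : rt 0 ≡ 0) (stⱼ : ∀ {j} → j < suc (dbl l) → st (suc j) ≡ 0) (suₙ : su N ≡ 0) where
            x~2 : R x (v (2 + z))
            x~2 = edge₂ z rt₀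
            y~a : R y a
            y~a = subst₂ R (cong v (sym (+-suc (dbl N) z))) (wrap 1) (edge₂ (suc (dbl N + z)) suₙ)
            diagonal : ∀ j → j < n → j ≢ 0 → j ≢ N → R (v (dbl j + (1 + z))) (v (suc (dbl j + (1 + z))))
            diagonal zero    _   0≢0 _   = contradiction refl 0≢0
            diagonal (suc j) j<n _   j≢N = edge₁ _ (trans (cong d₁ (+-suc (dbl (suc j)) z))
              (stⱼ (≤-pred (≤∧≢⇒< (≤-pred (≤-trans j<n (≤-reflexive n≡))) j≢N))))
            real : ∀ w → R w (mate (exchange flip a x) w)
            real w with exchange-view flip x≢a x≢fa w
            ... | at-a refl eq  = subst (R a) (sym (trans eq fx≡)) (R-sym y~a)
            ... | at-fa refl eq = subst₂ R (sym fa≡) (sym eq) (R-sym x~2)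
            ... | at-x refl eq  = subst (R x) (sym (trans eq fa≡)) x~2
            ... | at-fx refl eq = subst₂ R (sym fx≡) (sym eq) y~a
            ... | off w≢a w≢fa w≢x w≢fx eq with cover₂ (1 + z) w
            ...   | j , j<n , inj₁ refl = subst (R _) (sym (trans eq (flip-up j)))
                    (diagonal j j<n (λ { refl → w≢a refl }) (λ { refl → w≢fx (sym fx≡) }))
            ...   | j , j<n , inj₂ refl = subst (R _) (sym (trans eq (flip-down j)))
                    (R-sym (diagonal j j<n (λ { refl → w≢fa (sym fa≡) }) (λ { refl → w≢x x≡ })))
            absurd : ⊥
            -- The new pairing matches `a` with `y`, whereas `p` matches `a` with `x`.
            absurd = mate-≢ flip x (trans (sym (exchange-a flip x≢a x≢fa))
              (trans (p-unique (exchange flip a x) real a) (M-sym rung)))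

        -- The three cycles are edge-disjoint outside the rungs: their index ranges together use
        -- every even rail, odd rail and diagonal exactly once.
        3≤ : 3 ≤ RT + (ST + SU)
        3≤ = begin
          3   ≤⟨ +-mono-≤ even-track (+-mono-≤ odd-track twisted) ⟩
          (st 0 + ∑ N (rt ∘ suc)) + ((∑ N su + st N) + (rt 0 + ∑ (suc (dbl l)) (st ∘ suc) + su N))
            ≡⟨ regroup (st 0) (∑ N (rt ∘ suc)) (∑ N su) (st N) (rt 0) (∑ (suc (dbl l)) (st ∘ suc)) (su N) ⟩
          (rt 0 + ∑ N (rt ∘ suc)) + ((st 0 + ∑ (suc (dbl l)) (st ∘ suc) + st N) + (∑ N su + su N))
            ≡⟨ cong₂ (λ s t → s + (t + st N + (∑ N su + su N))) (∑-suc N rt) (∑-suc (suc (dbl l)) st) ⟨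
          ∑ (suc N) rt + (∑ (suc N) st + ∑ (suc N) su)
            ≡⟨ cong (λ s → ∑ s rt + (∑ s st + ∑ s su)) n≡ ⟨
          RT + (ST + SU) ∎
          where
          open ≤-Reasoning
          regroup : ∀ s₀ r u sₙ r₀ s uₙ →
            (s₀ + r) + ((u + sₙ) + (r₀ + s + uₙ)) ≡ (r₀ + r) + ((s₀ + s + sₙ) + (u + uₙ))
          regroup = solve-∀

        bound : q + q + 1 ≡ n → k + 8 ≤ 4 * card S
        bound 2q+1≡n = begin
          k + 8                          ≡⟨ cong (_+ 8) (trans k≡2n (trans (dbl≡2* n) (cong (2 *_) (sym 2q+1≡n)))) ⟩
          2 * (q + q + 1) + 8            ≤⟨ m≤m+n _ 2 ⟩
          2 * (q + q + 1) + 8 + 2        ≡⟨ s₁ q ⟩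
          4 * (q + 3)                    ≤⟨ *-monoʳ-≤ 4 (+-mono-≤ q≤K 3≤) ⟩
          4 * (K + (RT + (ST + SU)))     ≡⟨ cong (4 *_) (+-assoc K RT (ST + SU)) ⟨
          4 * (K + RT + (ST + SU))       ≤⟨ *-monoʳ-≤ 4 total ⟩
          4 * card S                     ∎
          where
          open ≤-Reasoning
          s₁ : ∀ q → 2 * (q + q + 1) + 8 + 2 ≡ 4 * (q + 3)
          s₁ = solve-∀

    private
      3≤n : 3 ≤ n
      3≤n = *-cancelˡ-≤ 2 (≤-trans 6≤k (≤-reflexive (trans k≡2n (dbl≡2* n))))

      dbl≡+ : ∀ q → dbl q ≡ q + q
      dbl≡+ q = trans (dbl≡2* q) (cong (q +_) (+-identityʳ q))

    no-rungs : ∀ z → Link z → ∑₂ z δ ≡ 0 → k + 8 ≤ 4 * card S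
    no-rungs z link d≡0 = go q refl
      where
      open Base z (inj₁ link)
      q+q≡n : q + q ≡ n
      q+q≡n = trans (sym (+-identityʳ (q + q))) (trans (cong (q + q +_) (sym d≡0)) count)
      go : ∀ c → q ≡ c → k + 8 ≤ 4 * card S
      go zero          eq = contradiction
        (≤-trans 3≤n (≤-reflexive (trans (sym q+q≡n) (cong₂ _+_ eq eq)))) λ ()
      go (suc zero)    eq = contradiction
        (≤-trans 3≤n (≤-reflexive (trans (sym q+q≡n) (cong₂ _+_ eq eq)))) λ { (s≤s (s≤s ())) }
      go (suc (suc l)) eq = NoRungs.bound link (∑≡0⇒ n (λ j → δ (dbl j + z)) d≡0) l
        (trans (sym q+q≡n) (trans (sym (dbl≡+ q)) (cong dbl eq))) q+q≡n

    one-rung : ∀ z → Even z → 0 < δ z → ∑₂ z δ ≡ 1 → k + 8 ≤ 4 * card S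
    one-rung z even 0<δz d≡1 = go even
      where
      ¬links : ¬ Link z × ¬ Link (2 + z)
      ¬links with Link? z | Link? (2 + z)
      ... | no ¬l | no ¬l′ = ¬l , ¬l′
      ... | yes _ | no _   = contradiction 0<δz (λ ())
      ... | yes _ | yes _  = contradiction 0<δz (λ ())
      ... | no _  | yes _  = contradiction 0<δz (λ ())
      go : Even z → k + 8 ≤ 4 * card S
      go (inj₁ l) = contradiction l (proj₁ ¬links)
      go (inj₂ s) with sep⇒ s
      ... | inj₂ l = contradiction l (proj₂ ¬links)
      ... | inj₁ (rung , sep) = finish q refl
        where
        -- The rung recorded by `δ z` starts at `2 + z`, so all counting starts there.
        open Base (2 + z) (inj₂ sep)
        2q+1≡n : q + q + 1 ≡ n
        2q+1≡n = trans (cong (q + q +_) (sym (trans (∑₂-rebase {δ} δ-per 1 z) d≡1))) count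
        tail : ∀ {N} → n ≡ suc N → ∑ N (λ j → δ (2 + (dbl j + z))) ≡ 0
        tail {N} n≡ = n≤0⇒n≡0 (+-cancelˡ-≤ 1 _ _ (≤-trans (+-monoˡ-≤ _ 0<δz) (≤-reflexive
          (trans (sym (∑-suc N (λ j → δ (dbl j + z))))
            (trans (cong (λ s → ∑ s (λ j → δ (dbl j + z))) (sym n≡)) d≡1)))))
        finish : ∀ c → q ≡ c → k + 8 ≤ 4 * card S
        finish zero    eq = contradiction
          (≤-trans 3≤n (≤-reflexive (trans (sym 2q+1≡n) (cong (λ c → c + c + 1) eq)))) λ { (s≤s ()) }
        finish (suc l) eq = OneRung.bound rung sep l n≡
          (λ {j} j<N → trans (cong δ (trans (+-suc (dbl j) (suc z)) (cong suc (+-suc (dbl j) z))))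
                             (∑≡0⇒ (2 + dbl l) (λ j → δ (2 + (dbl j + z))) (tail n≡) j<N))
          2q+1≡n
          where
          n≡ : n ≡ 3 + dbl l
          n≡ = trans (sym 2q+1≡n) (trans (+-comm (q + q) 1)
                 (cong suc (trans (sym (dbl≡+ q)) (cong dbl eq))))

    square : k + 8 ≤ 4 * card S
    square with even-start
    ... | z , even = go (∑₂ z δ) refl
      where
      open Base z even
      -- The sum of `δ` is n - 2q, the number of rungs in the matching: none, one, or at least two.
      go : ∀ d → ∑₂ z δ ≡ d → k + 8 ≤ 4 * card S
      go zero d≡0 = base even
        where
        base : Even z → k + 8 ≤ 4 * card S
        base (inj₁ l) = no-rungs z l d≡0
        base (inj₂ s) = no-rungs (2 + z)
          (sep⇒link s (∑≡0⇒ n (λ j → δ (dbl j + z)) d≡0 (≤-trans (s≤s z≤n) 3≤n)))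
          (trans (∑₂-rebase {δ} δ-per 1 z) d≡0)
      go (suc zero) d≡1 with ∑-find n (λ j → δ (dbl j + z)) (≤-reflexive (sym d≡1))
      ... | j , _ , 0<δ = one-rung (dbl j + z) (even-all even j) 0<δ (trans (∑₂-rebase {δ} δ-per j z) d≡1)
      go (suc (suc d)) eq = many-rungs (begin
        2 + (q + q)              ≡⟨ +-comm 2 (q + q) ⟩
        q + q + 2                ≤⟨ +-monoʳ-≤ (q + q) (s≤s (s≤s z≤n)) ⟩
        q + q + suc (suc d)      ≡⟨ trans (cong (q + q +_) (sym eq)) count ⟩
        n                        ∎)
        where open ≤-Reasoning

-- Assembly of the two bounds.

even⇒dbl : ∀ {k} n → k ≡ n * 2 → k ≡ dbl n
even⇒dbl n eq = trans eq (go n)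
  where
  go : ∀ n → n * 2 ≡ dbl n
  go 0       = refl
  go (suc n) = cong (λ s → suc (suc s)) (go n)

lowerBound : ∀ k ⦃ _ : NonZero k ⦄ n m → k ≡ dbl n → 6 ≤ k → 2 ≤ m →
  (S : EdgeSet (Power (Cycle k) m)) → IsAntiForcingSet (Power (Cycle k) m) S →
  k + 8 ≤ 4 * card S
lowerBound k n m k≡ 6≤k 2≤m S anti with m≤n⇒m<n∨m≡n 2≤m
... | inj₂ refl = SquareOfCycle.Square.square k n k≡ 6≤k S anti
... | inj₁ 3≤m with m≤n⇒m<n∨m≡n 6≤k
...   | inj₁ 7≤k = LowerBound.AntiForcing.large-k k S anti 3≤m 7≤k
...   | inj₂ 6≡k = LowerBound.AntiForcing.small-k k S anti 3≤m (sym 6≡k)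

theorem2p4 : (k m : ℕ) → 2 ∣ k → 6 ≤ k → 2 ≤ m → (a : ℕ)
    → IsAntiForcingNumber (Power (Cycle k) m) a
    → (k + 8 ≤ 4 * a) × (4 * a ≤ k * (k ∸ 2))
theorem2p4 k m (divides n k≡n*2) 6≤k 2≤m a ((S , anti , refl) , minimal) =
    lowerBound k n m k≡dbl 6≤k 2≤m S anti
  , ≤-trans (*-monoʳ-≤ 4 (minimal Above.S Above.antiForcing)) Above.upper
  where
  instance
    k≢0 : NonZero k
    k≢0 = >-nonZero (≤-trans (s≤s z≤n) 6≤k)
  k≡dbl = even⇒dbl n k≡n*2
  module Above = EvenCycle.Upper k n k≡dbl m (≤-trans (n≤1+n 1) 2≤m)
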